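{- Let $k\geq 1$ be an integer. Every $k$-queue graph is: $3k$-choosable with defect $1$, and thus with clustering $2$; $\lfloor\frac{14k+4}{5}\rfloor$-choosable with clustering $9$; and $\lfloor\frac{8k+2}{3}\rfloor$-choosable with clustering at most $152k-13$.
   Context: Graphs are finite and simple. A $k$-queue layout of a graph $G$ consists of a linear ordering $v_1,\dots,v_n$ of $V(G)$ and a partition $E_1,\dots,E_k$ of $E(G)$ such that for each $i$, no two edges in $E_i$ are nested, where edges $v_av_b$ and $v_cv_d$ are nested if $a<c<d<b$. A $k$-queue graph is a graph having a $k$-queue layout. In a coloured graph the monochromatic subgraph is the spanning subgraph of edges whose endpoints have the same colour; its connected components are monochromatic components. A colouring has defect $d$ if the monochromatic subgraph has maximum degree at most $d$, and clustering $c$ if every monochromatic component has at most $c$ vertices. A $k$-list-assignment $L$ assigns to each vertex $v$ a set $L(v)$ of at least $k$ colours; an $L$-colouring colours each $v$ with a colour from $L(v)$. $G$ is $k$-choosable with defect $d$ (resp. clustering $c$) if for every $k$-list-assignment $L$, $G$ has an $L$-colouring with defect $d$ (resp. clustering $c$). -}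

module Defs where

open import Data.Nat using (ℕ; _≤_; _<_; _≟_)
open import Data.Bool using (Bool; true; false)
open import Data.Fin using (Fin; toℕ)
open import Data.List using (List; length; filter; allFin)
open import Data.List.Membership.Propositional using (_∈_)
open import Data.List.Relation.Unary.All using (All)
open import Data.List.Relation.Unary.Unique.Propositional using (Unique)
open import Data.Product using (Σ; _×_; ∃)
open import Relation.Binary.PropositionalEquality using (_≡_; _≢_)
open import Relation.Nullary using (¬_)
open import Relation.Nullary.Decidable using (_×-dec_)
open import Data.Bool.Properties renaming (_≟_ to _≟B_)
open import Function.Definitions using (Injective)

record Graph : Set where
  field
    n     : ℕ
    adj   : Fin n → Fin n → Bool
    sym   : ∀ u v → adj u v ≡ adj v u
    irrefl : ∀ v → adj v v ≡ false
open Graph public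

Adj : (G : Graph) → Fin (n G) → Fin (n G) → Set
Adj G u v = adj G u v ≡ true

-- A k-queue layout: a linear ordering of V(G) (given by an injective
-- position map, i.e. a bijection onto positions 0..n-1) and a partition of
-- E(G) into k classes E_0..E_{k-1} (an edge uv gets the class part u v, and
-- part is symmetric on edges) with no two nested edges in the same class.
-- Edge uv (pos u < pos v) and xy (pos x < pos y) are nested if
-- pos u < pos x < pos y < pos v.
record QueueLayout (k : ℕ) (G : Graph) : Set where
  field
    pos      : Fin (n G) → Fin (n G)
    pos-inj  : Injective _≡_ _≡_ pos
    part     : Fin (n G) → Fin (n G) → Fin k
    part-sym : ∀ u v → Adj G u v → part u v ≡ part v u
    no-nest  : ∀ u v x y → Adj G u v → Adj G x y → part u v ≡ part x y →
               ¬ (toℕ (pos u) < toℕ (pos x) × toℕ (pos x) < toℕ (pos y)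
                  × toℕ (pos y) < toℕ (pos v))

IsQueueGraph : ℕ → Graph → Set
IsQueueGraph k G = QueueLayout k G

Colouring : Graph → Set
Colouring G = Fin (n G) → ℕ

monoDeg : (G : Graph) → Colouring G → Fin (n G) → ℕ
monoDeg G c v =
  length (filter (λ w → (adj G v w ≟B true) ×-dec (c w ≟ c v)) (allFin (n G)))

HasDefect : (G : Graph) → ℕ → Colouring G → Set
HasDefect G d c = ∀ v → monoDeg G c v ≤ d

data MonoReach (G : Graph) (c : Colouring G) (u : Fin (n G)) : Fin (n G) → Set where
  here : MonoReach G c u u
  step : ∀ {v w} → MonoReach G c u v → Adj G v w → c v ≡ c w → MonoReach G c u w

HasClustering : (G : Graph) → ℕ → Colouring G → Set
HasClustering G m c =
  ∀ v (ws : List (Fin (n G))) → Unique ws → All (MonoReach G c v) ws → length ws ≤ m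

IsListAssignment : (G : Graph) → ℕ → (Fin (n G) → List ℕ) → Set
IsListAssignment G k L = ∀ v → Unique (L v) × k ≤ length (L v)

Choosable : (G : Graph) → ℕ → (Colouring G → Set) → Set
Choosable G k P = ∀ (L : Fin (n G) → List ℕ) → IsListAssignment G k L →
  Σ (Colouring G) (λ c → (∀ v → c v ∈ L v) × P c)

{-# OPTIONS --safe #-}
module Submission where

open import Defs hiding (sym; here; step)
open import Data.Nat using (ℕ; zero; suc; _≤_; _<_; _*_; _+_; _∸_; _/_; _%_; _≟_; _≤?_; _<?_; z≤n; s≤s; NonZero; >-nonZero)
open import Data.Product using (_×_; Σ; ∃; _,_; proj₁; proj₂)
open import Data.Bool using (Bool; true; false; _∧_; not; if_then_else_)
open import Data.Bool.Properties using () renaming (_≟_ to _≟ᵇ_)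
open import Data.Empty using (⊥)
open import Data.Fin using (Fin; zero; suc)
import Data.Fin as F
open import Data.Fin.Properties using (all?; injective⇒≤; suc-injective; toℕ-injective; toℕ-fromℕ<)
open import Data.List using (List; []; _∷_; length; _++_; allFin; filter; tabulate; cartesianProduct)
import Data.List as List
open import Data.List.Membership.Propositional using (_∈_; _∉_; find; lose)
open import Data.List.Membership.Propositional.Properties using (∈-lookup; ∈-allFin; ∈-cartesianProduct⁺)
open import Data.List.Relation.Unary.All using (All)
import Data.List.Relation.Unary.All as All
open import Data.List.Relation.Unary.AllPairs using ([]; _∷_)
open import Data.List.Relation.Unary.Any using (Any; here; there; any?)
import Data.List.Relation.Unary.Any as Any
open import Data.List.Relation.Unary.Any.Properties using (lookup-index)
open import Data.List.Relation.Unary.Unique.Propositional using (Unique)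
open import Data.Nat.DivMod using (m≡m%n+[m/n]*n; m%n<n)
open import Data.Nat.Induction using (<-rec)
open import Data.Nat.Properties hiding (_≟_; _≤?_; _<?_; suc-injective)
open import Data.Nat.Tactic.RingSolver using (solve-∀)
open import Data.Product.Properties using (≡-dec)
open import Data.Sum using (_⊎_; inj₁; inj₂; [_,_])
open import Data.Vec.Functional using () renaming (_∷_ to _▹_)
open import Function using (_∘_)
open import Relation.Binary.Definitions using (tri<; tri≈; tri>)
open import Relation.Binary.PropositionalEquality hiding ([_])
open import Relation.Nullary using (¬_; Dec; yes; no; contradiction)
open import Relation.Nullary.Decidable using (¬¬-excluded-middle; decidable-stable; _×-dec_; _→-dec_; map′)

open import Algebra.Properties.Semiring.Sum +-*-semiring
  using (sum; sum-cong-≗; ∑-distrib-+; ∑-comm; *-distribˡ-sum; *-distribʳ-sum)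

-- Every nonempty vertex set U of a k-queue graph spans fewer than 2k|U| edges.  Put t = 1 for
-- defect 1 and t = 2 for bounded clustering.  By induction, U ∖ S is already coloured by g for a
-- suitable smallest S ⊆ U, and its minimality makes every X ⊆ S sparse.  Weigh an edge inside S by 1
-- and an edge from S to U ∖ S by t + 1, and let f extend g to S with the least possible
-- monochromatic weight.  Sparsity bounds the monochromatic weight at each vertex of S by t, which
-- rules out conflicts with g and settles t = 1.
--
-- For t = 2 the monochromatic components become small after deleting all vertices; the vertices are
-- put back one at a time, v being the current "hole".  If a colour c occurs on exactly two
-- neighbours z₁, z₂ of v, recolour v with c at no cost, hold v fixed and make z₁ the hole.  If that
-- hole can be filled, then v keeps at most the neighbour z₂ in its colour, so either v itself is
-- fine or z₂ is the next hole.  Hence, if v cannot be filled, each colour c of its list occurs on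
-- three neighbours, or on two of which one is again an unfillable hole; summing this over the set X
-- of all unfillable holes contradicts the sparsity of X.  The components obtained have at most
-- 3 vertices, whenever the lists have at least 8k/3 colours.
--
-- Minimal objects and the set X are only obtained up to double negation; a search through the
-- finitely many list colourings, together with a witness for small components, removes it.

-- Indicators and finite sums of natural numbers.

𝟙 : ∀ {P : Set} → Dec P → ℕ
𝟙 (yes _) = 1
𝟙 (no _)  = 0

𝟙-yes : ∀ {P : Set} (P? : Dec P) → P → 𝟙 P? ≡ 1
𝟙-yes (yes _) _ = refl
𝟙-yes (no ¬p) p = contradiction p ¬p

𝟙-no : ∀ {P : Set} (P? : Dec P) → ¬ P → 𝟙 P? ≡ 0
𝟙-no (yes p) ¬p = contradiction p ¬p
𝟙-no (no _)  _  = refl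

⟦_⟧ : Bool → ℕ
⟦ true ⟧  = 1
⟦ false ⟧ = 0

private variable
  d : ℕ
  A : Set

sum-mono-≤ : {h k : Fin d → ℕ} → (∀ i → h i ≤ k i) → sum h ≤ sum k
sum-mono-≤ {zero}  h≤k = z≤n
sum-mono-≤ {suc n} h≤k = +-mono-≤ (h≤k zero) (sum-mono-≤ (h≤k ∘ suc))

sum-zero : {h : Fin d → ℕ} → (∀ i → h i ≡ 0) → sum h ≡ 0
sum-zero {zero}  h≡0 = refl
sum-zero {suc n} h≡0 = cong₂ _+_ (h≡0 zero) (sum-zero (h≡0 ∘ suc))

sum-strict-≤ : {h k : Fin d → ℕ} → (∀ i → h i ≤ k i) → ∀ i → h i < k i → sum h < sum k
sum-strict-≤ h≤k zero    h<k = +-mono-<-≤ h<k (sum-mono-≤ (h≤k ∘ suc))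
sum-strict-≤ h≤k (suc i) h<k = +-mono-≤-< (h≤k zero) (sum-strict-≤ (h≤k ∘ suc) i h<k)

without : (Fin d → ℕ) → Fin d → Fin d → ℕ
without h v i with i F.≟ v
... | yes _ = 0
... | no  _ = h i

without-self : (h : Fin d → ℕ) (v : Fin d) → without h v v ≡ 0
without-self h v with v F.≟ v
... | yes _  = refl
... | no v≢v = contradiction refl v≢v

without-other : (h : Fin d → ℕ) {v i : Fin d} → i ≢ v → without h v i ≡ h i
without-other h {v} {i} i≢v with i F.≟ v
... | yes i≡v = contradiction i≡v i≢v
... | no  _   = refl

sum-split : (v : Fin d) (k : Fin d → ℕ) → sum k ≡ k v + sum (without k v)
sum-split zero    k = refl
sum-split (suc v) k = begin
  k zero + sum (k ∘ suc)                                  ≡⟨ cong (k zero +_) (sum-split v (k ∘ suc)) ⟩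
  k zero + (k (suc v) + sum (without (k ∘ suc) v))        ≡⟨ +-assoc (k zero) _ _ ⟨
  (k zero + k (suc v)) + sum (without (k ∘ suc) v)        ≡⟨ cong (_+ sum (without (k ∘ suc) v)) (+-comm (k zero) _) ⟩
  (k (suc v) + k zero) + sum (without (k ∘ suc) v)        ≡⟨ +-assoc (k (suc v)) _ _ ⟩
  k (suc v) + (k zero + sum (without (k ∘ suc) v))        ≡⟨ cong (λ x → k (suc v) + (k zero + x)) (sum-cong-≗ shift) ⟩
  k (suc v) + (k zero + sum (without k (suc v) ∘ suc))    ∎
  where
  open ≡-Reasoning
  shift : ∀ i → without (k ∘ suc) v i ≡ without k (suc v) (suc i)
  shift i with i F.≟ v
  ... | yes _ = refl
  ... | no  _ = refl

term≤sum : (h : Fin d → ℕ) (v : Fin d) → h v ≤ sum h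
term≤sum h v = ≤-trans (m≤m+n (h v) _) (≤-reflexive (sym (sum-split v h)))

sum-positive : (h : Fin d → ℕ) → 1 ≤ sum h → ∃ λ v → 1 ≤ h v
sum-positive {suc n} h pos with h zero in eq
... | suc _ = zero , ≤-trans (s≤s z≤n) (≤-reflexive (sym eq))
... | zero  with sum-positive (h ∘ suc) pos
...   | v , p = suc v , p

support-one : (h : Fin d → ℕ) → sum h ≤ 1 → ∀ {v} → 1 ≤ h v → ∀ {u} → 1 ≤ h u → u ≡ v
support-one h h≤1 {v} pv {u} pu with u F.≟ v
... | yes u≡v = u≡v
... | no  u≢v = contradiction
  (begin
    2                        ≤⟨ +-mono-≤ pv pu ⟩
    h v + h u                ≡⟨ cong (h v +_) (without-other h u≢v) ⟨
    h v + without h v u      ≤⟨ +-monoʳ-≤ (h v) (term≤sum (without h v) u) ⟩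
    h v + sum (without h v)  ≡⟨ sum-split v h ⟨
    sum h                    ≤⟨ h≤1 ⟩
    1                        ∎)
  λ { (s≤s ()) }
  where open ≤-Reasoning

-- The two witnesses coincide when a single index carries the whole weight 2.
support-two : (h : Fin d → ℕ) → sum h ≡ 2 →
  ∃ λ z₁ → ∃ λ z₂ → 1 ≤ h z₁ × 1 ≤ h z₂ × (∀ u → 1 ≤ h u → u ≡ z₁ ⊎ u ≡ z₂)
support-two h h≡2 with sum-positive h (≤-trans (s≤s z≤n) (≤-reflexive (sym h≡2)))
... | z , pz with 1 ≤? sum (without h z)
...   | no  none = z , z , pz , pz , λ u pu → inj₁ (cover u pu)
  where
  cover : ∀ u → 1 ≤ h u → u ≡ z
  cover u pu with u F.≟ z
  ... | yes u≡z = u≡z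
  ... | no  u≢z = contradiction
    (≤-trans pu (≤-trans (≤-reflexive (sym (without-other h u≢z))) (term≤sum (without h z) u))) none
...   | yes some with sum-positive (without h z) some
...     | y , py = z , y , pz , hy , cover
  where
  y≢z : y ≢ z
  y≢z refl = contradiction (≤-trans py (≤-reflexive (without-self h z))) λ ()
  hy : 1 ≤ h y
  hy = ≤-trans py (≤-reflexive (without-other h y≢z))
  rest≤1 : sum (without h z) ≤ 1
  rest≤1 = +-cancelˡ-≤ 1 _ _ (≤-trans (+-monoˡ-≤ _ pz) (≤-reflexive (trans (sym (sum-split z h)) h≡2)))
  cover : ∀ u → 1 ≤ h u → u ≡ z ⊎ u ≡ y
  cover u pu with u F.≟ z
  ... | yes u≡z = inj₁ u≡z
  ... | no  u≢z = inj₂ (support-one (without h z) rest≤1 py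
                    (≤-trans pu (≤-reflexive (sym (without-other h u≢z)))))

sum-at-most-one : (h : Fin d → ℕ) → (∀ i → h i ≤ 1) →
  (∀ i j → 1 ≤ h i → 1 ≤ h j → i ≡ j) → sum h ≤ 1
sum-at-most-one {zero}  h h≤1 same = z≤n
sum-at-most-one {suc n} h h≤1 same with 1 ≤? h zero
... | no  h₀≱1 = +-mono-≤ {h zero} (≤-pred (≰⇒> h₀≱1))
        (sum-at-most-one (h ∘ suc) (h≤1 ∘ suc) λ i j p q → suc-injective (same _ _ p q))
... | yes h₀≥1 = ≤-trans (≤-reflexive (trans (cong (h zero +_) (sum-zero rest)) (+-identityʳ _))) (h≤1 zero)
  where
  rest : ∀ i → h (suc i) ≡ 0
  rest i with h (suc i) in eq
  ... | zero  = refl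
  ... | suc _ with () ← same zero (suc i) h₀≥1 (≤-trans (s≤s z≤n) (≤-reflexive (sym eq)))

sum-const : ∀ n (c : ℕ) → sum {n} (λ _ → c) ≡ n * c
sum-const zero    c = refl
sum-const (suc n) c = cong (c +_) (sum-const n c)

sum-𝟙 : (v : Fin d) (h : Fin d → ℕ) → sum (λ u → 𝟙 (u F.≟ v) * h u) ≡ h v
sum-𝟙 v h = begin
  sum k                     ≡⟨ sum-split v k ⟩
  k v + sum (without k v)   ≡⟨ cong₂ _+_ (trans (cong (_* h v) (𝟙-yes (v F.≟ v) refl)) (*-identityˡ _)) (sum-zero rest) ⟩
  h v + 0                   ≡⟨ +-identityʳ _ ⟩
  h v                       ∎
  where
  open ≡-Reasoning
  k : Fin _ → ℕ
  k u = 𝟙 (u F.≟ v) * h u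
  rest : ∀ u → without k v u ≡ 0
  rest u with u F.≟ v
  ... | yes _   = refl
  ... | no  u≢v = cong (_* h u) (𝟙-no (u F.≟ v) u≢v)

-- Pigeonhole over the colours of a list: `u` has the one colour `f u`, so its weight is spent on at
-- most one entry of `L`. Once `c` is treated, `other` erases the weight of all vertices coloured
-- `c`.
colour-bound : ∀ (m : ℕ) (a : Fin d → ℕ) (f : Fin d → ℕ) {L : List ℕ} → Unique L →
  (∀ c → c ∈ L → m ≤ sum (λ u → a u * 𝟙 (f u ≟ c))) → length L * m ≤ sum a
colour-bound m a f [] low = z≤n
colour-bound {d} m a f {c ∷ L} (c∉L ∷ uniq) low = begin
  m + length L * m                    ≤⟨ +-mono-≤ (low c (here refl)) (colour-bound m other f uniq low′) ⟩
  sum (λ u → a u * 𝟙 (f u ≟ c)) + sum other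
                                      ≡⟨ ∑-distrib-+ (λ u → a u * 𝟙 (f u ≟ c)) other ⟨
  sum (λ u → a u * 𝟙 (f u ≟ c) + other u)
                                      ≤⟨ sum-mono-≤ (λ u → ≤-reflexive (recombine u)) ⟩
  sum a                               ∎
  where
  open ≤-Reasoning
  other : Fin d → ℕ
  other u with f u ≟ c
  ... | yes _ = 0
  ... | no  _ = a u
  recombine : ∀ u → a u * 𝟙 (f u ≟ c) + other u ≡ a u
  recombine u with f u ≟ c
  ... | yes _ = trans (+-identityʳ _) (*-identityʳ (a u))
  ... | no  _ = cong (_+ a u) (*-zeroʳ (a u))
  same : ∀ {c′} → c ≢ c′ → ∀ u → a u * 𝟙 (f u ≟ c′) ≡ other u * 𝟙 (f u ≟ c′)
  same {c′} c≢c′ u with f u ≟ c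
  ... | no  _    = refl
  ... | yes refl rewrite 𝟙-no (f u ≟ c′) c≢c′ = *-zeroʳ (a u)
  low′ : ∀ c′ → c′ ∈ L → m ≤ sum (λ u → other u * 𝟙 (f u ≟ c′))
  low′ c′ c′∈L = ≤-trans (low c′ (there c′∈L)) (≤-reflexive (sum-cong-≗ (same (All.lookup c∉L c′∈L))))

-- Comparing lengths of lists without repetitions.

unique⇒lookup-injective : {xs : List A} → Unique xs → ∀ {i j} →
  List.lookup xs i ≡ List.lookup xs j → i ≡ j
unique⇒lookup-injective (x∉xs ∷ uniq) {zero}  {zero}  eq = refl
unique⇒lookup-injective (x∉xs ∷ uniq) {zero}  {suc j} eq = contradiction eq (All.lookup x∉xs (∈-lookup j))
unique⇒lookup-injective (x∉xs ∷ uniq) {suc i} {zero}  eq = contradiction (sym eq) (All.lookup x∉xs (∈-lookup i))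
unique⇒lookup-injective (x∉xs ∷ uniq) {suc i} {suc j} eq = cong suc (unique⇒lookup-injective uniq eq)

unique-⊆⇒length≤ : {xs ys : List A} → Unique xs → All (_∈ ys) xs → length xs ≤ length ys
unique-⊆⇒length≤ {xs = xs} {ys} uniq sub = injective⇒≤ {f = position} position-injective
  where
  member : ∀ i → List.lookup xs i ∈ ys
  member i = All.lookup sub (∈-lookup i)
  position : Fin (length xs) → Fin (length ys)
  position i = Any.index (member i)
  lookup-position : ∀ i → List.lookup xs i ≡ List.lookup ys (position i)
  lookup-position i = lookup-index (member i)
  position-injective : ∀ {i j} → position i ≡ position j → i ≡ j
  position-injective {i} {j} eq = unique⇒lookup-injective uniq
    (trans (lookup-position i) (trans (cong (List.lookup ys) eq) (sym (lookup-position j))))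

-- Minimal objects and decisions up to double negation.

module _ {A : Set} (P : A → Set) (μ : A → ℕ) where

  -- If no element is minimal, every element has one of smaller measure, and strong induction on the
  -- measure refutes them all. `P` may be undecidable, so no minimal element can be computed.
  ¬¬-minimal : ∃ P → ¬ ¬ ∃ λ a → P a × (∀ b → P b → μ a ≤ μ b)
  ¬¬-minimal (a , pa) none = <-rec (λ m → ∀ a → P a → μ a ≡ m → ⊥) step (μ a) a pa refl
    where
    step : ∀ m → (∀ {k} → k < m → ∀ a → P a → μ a ≡ k → ⊥) → ∀ a → P a → μ a ≡ m → ⊥
    step m rec a pa refl = none (a , pa , λ b pb →
      decidable-stable (μ a ≤? μ b) λ μa≰μb → rec (≰⇒> μa≰μb) b pb refl)

-- Double negation commutes with finite conjunctions, so excluded middle can be used at each vertex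
-- in turn.
¬¬-decide : ∀ {n} (P : Fin n → Set) → ¬ ¬ (∀ v → Dec (P v))
¬¬-decide {zero}  P none = none λ ()
¬¬-decide {suc n} P none = ¬¬-excluded-middle λ P₀? → ¬¬-decide (P ∘ suc) λ P? →
  none λ { zero → P₀? ; (suc v) → P? v }

-- Energy of colourings and the effect of recolouring one vertex.

-- Row and column `v` have equal sums and meet in a zero entry. Recolouring `v` changes only these
-- two lines of the monochromatic weight matrix.
sum-symmetric : ∀ {n} (m : Fin n → Fin n → ℕ) (v : Fin n) → (∀ u → m u v ≡ m v u) → m v v ≡ 0 →
  sum (λ a → sum (m a)) ≡ 2 * sum (m v) + sum (without (λ a → sum (without (m a) v)) v)
sum-symmetric m v m-sym m-diag = begin
  sum (λ a → sum (m a))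
    ≡⟨ sum-split v _ ⟩
  sum (m v) + sum (without (λ a → sum (m a)) v)
    ≡⟨ cong (sum (m v) +_) (trans (sum-cong-≗ column) (∑-distrib-+ (m v) rest)) ⟩
  sum (m v) + (sum (m v) + sum rest)
    ≡⟨ regroup (sum (m v)) (sum rest) ⟩
  2 * sum (m v) + sum rest ∎
  where
  open ≡-Reasoning
  rest : Fin _ → ℕ
  rest = without (λ a → sum (without (m a) v)) v
  regroup : ∀ x y → x + (x + y) ≡ 2 * x + y
  regroup = solve-∀
  column : ∀ a → without (λ a → sum (m a)) v a ≡ m v a + rest a
  column a with a F.≟ v
  ... | yes refl = sym (trans (+-identityʳ _) m-diag)
  ... | no  _    = trans (sum-split v (m a)) (cong (_+ sum (without (m a) v)) (m-sym a))

_[_≔_] : ∀ {n} → (Fin n → ℕ) → Fin n → ℕ → Fin n → ℕ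
(f [ v ≔ c ]) u with u F.≟ v
... | yes _ = c
... | no  _ = f u

≔-at : ∀ {n} (f : Fin n → ℕ) v c → (f [ v ≔ c ]) v ≡ c
≔-at f v c with v F.≟ v
... | yes _  = refl
... | no v≢v = contradiction refl v≢v

≔-off : ∀ {n} (f : Fin n → ℕ) {v c u} → u ≢ v → (f [ v ≔ c ]) u ≡ f u
≔-off f {v} {c} {u} u≢v with u F.≟ v
... | yes u≡v = contradiction u≡v u≢v
... | no  _   = refl

weighted-indicator : ∀ {w} {P : Set} (P? : Dec P) → 1 ≤ w * 𝟙 P? → 1 ≤ w × P
weighted-indicator {w} (yes p) pos = ≤-trans pos (≤-reflexive (*-identityʳ w)) , p
weighted-indicator {w} (no _)  pos = contradiction (≤-trans pos (≤-reflexive (*-zeroʳ w))) λ ()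

weighted-indicator⁻¹ : ∀ {w} {P : Set} (P? : Dec P) → P → w ≤ w * 𝟙 P?
weighted-indicator⁻¹ {w} P? p = ≤-reflexive (sym (trans (cong (w *_) (𝟙-yes P? p)) (*-identityʳ w)))

module Colourings {n : ℕ} (ω : Fin n → Fin n → ℕ)
  (ω-sym : ∀ u v → ω u v ≡ ω v u) (ω-diag : ∀ v → ω v v ≡ 0)
  (L : Fin n → List ℕ) (S : Fin n → Bool) (g : Fin n → ℕ) where

  cost : (Fin n → ℕ) → Fin n → ℕ → ℕ
  cost f v c = sum λ u → ω v u * 𝟙 (f u ≟ c)

  -- Each monochromatic edge is counted from both ends, which is why `energy-≔` has the factor 2.
  energy : (Fin n → ℕ) → ℕ
  energy f = sum λ v → cost f v (f v)

  Valid : (Fin n → ℕ) → Set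
  Valid f = (∀ v → f v ∈ L v) × (∀ v → S v ≡ false → f v ≡ g v)

  Optimal : (Fin n → ℕ) → Set
  Optimal f = Valid f × (∀ f′ → Valid f′ → energy f ≤ energy f′)

  neighbour-≢ : ∀ {u v} → 1 ≤ ω u v → u ≢ v
  neighbour-≢ {u} ωuv refl = contradiction (≤-trans ωuv (≤-reflexive (ω-diag u))) λ ()

  neighbour-sym : ∀ {k u v} → k ≤ ω u v → k ≤ ω v u
  neighbour-sym {u = u} {v} k≤ = ≤-trans k≤ (≤-reflexive (ω-sym u v))

  ω≤cost : ∀ f v c u → f u ≡ c → ω v u ≤ cost f v c
  ω≤cost f v c u fu≡c = ≤-trans (weighted-indicator⁻¹ (f u ≟ c) fu≡c)
                               (term≤sum (λ u → ω v u * 𝟙 (f u ≟ c)) u)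

  same-neighbour : ∀ f z → cost f z (f z) ≤ 1 → ∀ {v w} →
    1 ≤ ω z v → f v ≡ f z → 1 ≤ ω z w → f w ≡ f z → w ≡ v
  same-neighbour f z cost≤1 {v} {w} ωzv fv ωzw fw =
    support-one (λ u → ω z u * 𝟙 (f u ≟ f z)) cost≤1
      (≤-trans ωzv (weighted-indicator⁻¹ (f v ≟ f z) fv))
      (≤-trans ωzw (weighted-indicator⁻¹ (f w ≟ f z) fw))

  cost-≔ : ∀ f v c c′ → cost (f [ v ≔ c ]) v c′ ≡ cost f v c′
  cost-≔ f v c c′ = sum-cong-≗ term
    where
    term : ∀ u → ω v u * 𝟙 ((f [ v ≔ c ]) u ≟ c′) ≡ ω v u * 𝟙 (f u ≟ c′)
    term u with u F.≟ v
    ... | no  _    = refl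
    ... | yes refl rewrite ω-diag v = refl

  energy-≔ : ∀ f v c → energy (f [ v ≔ c ]) + 2 * cost f v (f v) ≡ energy f + 2 * cost f v c
  energy-≔ f v c = begin
    energy f′ + 2 * cost f v (f v)
      ≡⟨ cong (_+ 2 * cost f v (f v)) (split f′) ⟩
    2 * cost f′ v (f′ v) + rest f′ + 2 * cost f v (f v)
      ≡⟨ cong₂ (λ x y → 2 * x + y + 2 * cost f v (f v)) row same-rest ⟩
    2 * cost f v c + rest f + 2 * cost f v (f v)
      ≡⟨ regroup (cost f v c) (rest f) (cost f v (f v)) ⟩
    2 * cost f v (f v) + rest f + 2 * cost f v c
      ≡⟨ cong (_+ 2 * cost f v c) (split f) ⟨
    energy f + 2 * cost f v c ∎
    where
    open ≡-Reasoning
    f′ = f [ v ≔ c ]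
    m : (Fin n → ℕ) → Fin n → Fin n → ℕ
    m f a b = ω a b * 𝟙 (f b ≟ f a)
    rest : (Fin n → ℕ) → ℕ
    rest f = sum (without (λ a → sum (without (m f a) v)) v)
    𝟙-sym : ∀ x y → 𝟙 (x ≟ y) ≡ 𝟙 (y ≟ x)
    𝟙-sym x y with x ≟ y
    ... | yes x≡y = sym (𝟙-yes (y ≟ x) (sym x≡y))
    ... | no  x≢y = sym (𝟙-no (y ≟ x) (x≢y ∘ sym))
    split : ∀ f → energy f ≡ 2 * cost f v (f v) + rest f
    split f = sum-symmetric (m f) v (λ u → cong₂ _*_ (ω-sym u v) (𝟙-sym (f v) (f u)))
                (cong (_* 𝟙 (f v ≟ f v)) (ω-diag v))
    row : cost f′ v (f′ v) ≡ cost f v c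
    row = trans (cong (cost f′ v) (≔-at f v c)) (cost-≔ f v c c)
    same-rest : rest f′ ≡ rest f
    same-rest = sum-cong-≗ outer
      where
      inner : ∀ {a} → a ≢ v → ∀ b → without (m f′ a) v b ≡ without (m f a) v b
      inner {a} a≢v b with b F.≟ v
      ... | yes _   = refl
      ... | no  b≢v = cong₂ (λ x y → ω a b * 𝟙 (x ≟ y)) (≔-off f b≢v) (≔-off f a≢v)
      outer : ∀ a → without (λ a → sum (without (m f′ a) v)) v a ≡ without (λ a → sum (without (m f a) v)) v a
      outer a with a F.≟ v
      ... | yes _   = refl
      ... | no  a≢v = sum-cong-≗ (inner a≢v)
    regroup : ∀ x y z → 2 * x + y + 2 * z ≡ 2 * z + y + 2 * x
    regroup = solve-∀

  valid-≔ : ∀ {f v c} → Valid f → S v ≡ true → c ∈ L v → Valid (f [ v ≔ c ])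
  valid-≔ {f} {v} {c} (f∈L , f≡g) v∈S c∈L = in-list , off-S
    where
    in-list : ∀ u → (f [ v ≔ c ]) u ∈ L u
    in-list u with u F.≟ v
    ... | yes refl = c∈L
    ... | no  _    = f∈L u
    off-S : ∀ u → S u ≡ false → (f [ v ≔ c ]) u ≡ g u
    off-S u u∉S with u F.≟ v
    ... | yes refl with () ← trans (sym v∈S) u∉S
    ... | no  _    = f≡g u u∉S

  optimal-cost≤ : ∀ {f v c} → Optimal f → S v ≡ true → c ∈ L v → cost f v (f v) ≤ cost f v c
  optimal-cost≤ {f} {v} {c} (valid , minimal) v∈S c∈L =
    *-cancelˡ-≤ 2 (+-cancelˡ-≤ (energy f) _ _ (begin
      energy f + 2 * cost f v (f v)              ≤⟨ +-monoˡ-≤ _ (minimal _ (valid-≔ valid v∈S c∈L)) ⟩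
      energy (f [ v ≔ c ]) + 2 * cost f v (f v)  ≡⟨ energy-≔ f v c ⟩
      energy f + 2 * cost f v c                  ∎))
    where open ≤-Reasoning

  optimal-≔ : ∀ {f v c} → Optimal f → S v ≡ true → c ∈ L v →
    cost f v c ≡ cost f v (f v) → Optimal (f [ v ≔ c ])
  optimal-≔ {f} {v} {c} (valid , minimal) v∈S c∈L tight = valid-≔ valid v∈S c∈L ,
    λ f′ valid′ → ≤-trans (≤-reflexive same-energy) (minimal f′ valid′)
    where
    same-energy : energy (f [ v ≔ c ]) ≡ energy f
    same-energy = +-cancelʳ-≡ (2 * cost f v (f v)) _ _
      (trans (energy-≔ f v c) (cong (λ x → energy f + 2 * x) tight))

  ¬¬-optimal : (∀ v → g v ∈ L v) → ¬ ¬ ∃ Optimal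
  ¬¬-optimal g∈L none = ¬¬-minimal Valid energy (g , g∈L , λ _ _ → refl) none

  module Sparse (q t : ℕ) (L-unique : ∀ v → Unique (L v)) (L-large : ∀ v → q ≤ length (L v))
    (degree< : ∀ v → S v ≡ true → sum (ω v) < q * t)
    (boundary : ∀ u v → S u ≡ false → 1 ≤ ω u v → S v ≡ true × t ≤ ω u v) where

    -- If `v` had cost at least `t`, then by optimality so would every colour of its list, and
    -- `colour-bound` would put weight `q * t` at `v`, more than `degree<` allows.
    optimal-cost< : ∀ {f v} → Optimal f → S v ≡ true → cost f v (f v) < t
    optimal-cost< {f} {v} opt v∈S = ≰⇒> λ t≤cost → <⇒≱ (degree< v v∈S)
      (≤-trans (*-monoˡ-≤ t (L-large v))
        (colour-bound t (ω v) f (L-unique v) λ c c∈L → ≤-trans t≤cost (optimal-cost≤ opt v∈S c∈L)))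

    -- An edge leaving `S` weighs at least `t`, so if monochromatic it alone would exceed the cost
    -- allowed at its end in `S`.
    mono-inside : ∀ {f u v} → Optimal f → 1 ≤ ω u v → f v ≡ f u → S u ≡ true
    mono-inside {f} {u} {v} opt ωuv fv≡fu with S u in eq
    ... | true  = refl
    ... | false with boundary u v eq ωuv
    ...   | v∈S , t≤ω = contradiction
      (≤-trans (neighbour-sym t≤ω) (ω≤cost f v (f v) u (sym fv≡fu)))
      (<⇒≱ (optimal-cost< opt v∈S))

-- Monochromatic components covered by blocks of at most three vertices.

-- A triple, with repetitions for smaller sets: equality is then decidable and there are finitely
-- many blocks, as the final search requires.
Block : ℕ → Set
Block n = Fin n × Fin n × Fin n

elements : ∀ {n} → Block n → List (Fin n)
elements (a , b , c) = a ∷ b ∷ c ∷ []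

module Clusters {n : ℕ} (ω : Fin n → Fin n → ℕ)
  (ω-sym : ∀ u v → ω u v ≡ ω v u) (ω-diag : ∀ v → ω v v ≡ 0)
  (L : Fin n → List ℕ) (S : Fin n → Bool) (g : Fin n → ℕ)
  (q : ℕ) (L-unique : ∀ v → Unique (L v)) (L-large : ∀ v → q ≤ length (L v))
  (degree< : ∀ v → S v ≡ true → sum {n} (ω v) < q * 3)
  (boundary : ∀ u v → S u ≡ false → 1 ≤ ω u v → S v ≡ true × 3 ≤ ω u v)
  -- An edge inside `X` is credited twice at each of its ends. In `colour-degree` the second credit
  -- pays for a neighbour that is again a hole.
  (sparse : ∀ (X : Fin n → Bool) → (∀ v → X v ≡ true → S v ≡ true) → ∀ v → X v ≡ true →
    sum {n} (λ v → ⟦ X v ⟧ * sum {n} (λ u → ω v u + ⟦ X u ⟧ * ω v u)) < sum {n} (λ v → ⟦ X v ⟧ * (q * 3)))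
  where

  open Colourings ω ω-sym ω-diag L S g
  open Sparse q 3 L-unique L-large degree< boundary
  open import Data.List.Membership.DecPropositional (F._≟_ {n}) using (_∈?_)

  -- B u contains the monochromatic component of u after deletion of D.
  Small : List (Fin n) → (Fin n → ℕ) → Set
  Small D f = Σ (Fin n → Block n) λ B → (∀ u → u ∈ elements (B u)) ×
    (∀ u w → u ∉ D → w ∉ D → 1 ≤ ω u w → f w ≡ f u → B u ≡ B w)

  small-mono : ∀ {D D′ f f′} → (∀ {u} → u ∈ D → u ∈ D′) → (∀ u → u ∉ D′ → f′ u ≡ f u) →
    Small D f → Small D′ f′
  small-mono D⊆D′ f′≡f (B , self , closed) = B , self , λ u w u∉ w∉ ωuw eq →
    closed u w (u∉ ∘ D⊆D′) (w∉ ∘ D⊆D′) ωuw (trans (sym (f′≡f w w∉)) (trans eq (f′≡f u u∉)))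

  -- `C` becomes the block of all its vertices, `x` included. No monochromatic edge outside `D`
  -- leaves `C`, so the old blocks still serve the vertices off `C`.
  small-adjoin : ∀ {x D f} → Small (x ∷ D) f → (C : Block n) → x ∈ elements C →
    (∀ u w → u ∈ elements C → w ∉ D → 1 ≤ ω u w → f w ≡ f u → w ∈ elements C) → Small D f
  small-adjoin {x} {D} {f} (B , self , same) C x∈C closed = B′ , self′ , same′
    where
    B′ : Fin n → Block n
    B′ u with u ∈? elements C
    ... | yes _ = C
    ... | no  _ = B u
    self′ : ∀ u → u ∈ elements (B′ u)
    self′ u with u ∈? elements C
    ... | yes u∈C = u∈C
    ... | no  _   = self u
    extend : ∀ {u} → u ∉ D → u ∉ elements C → u ∉ x ∷ D
    extend u∉D u∉C (here refl) = u∉C x∈C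
    extend u∉D u∉C (there u∈D) = u∉D u∈D
    same′ : ∀ u w → u ∉ D → w ∉ D → 1 ≤ ω u w → f w ≡ f u → B′ u ≡ B′ w
    same′ u w u∉D w∉D ωuw eq with u ∈? elements C | w ∈? elements C
    ... | yes _   | yes _   = refl
    ... | yes u∈C | no  w∉C = contradiction (closed u w u∈C w∉D ωuw eq) w∉C
    ... | no  u∉C | yes w∈C = contradiction (closed w u w∈C u∉D (neighbour-sym ωuw) (sym eq)) u∉C
    ... | no  u∉C | no  w∉C = same u w (extend u∉D u∉C) (extend w∉D w∉C) ωuw eq

  single : Fin n → Block n
  single x = x , x , x

  small-isolated : ∀ {x D f} → Small (x ∷ D) f →
    (∀ w → w ∉ D → 1 ≤ ω x w → f w ≢ f x) → Small D f
  small-isolated {x} {D} {f} small isolated = small-adjoin small (single x) (here refl) closed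
    where
    closed : ∀ u w → u ∈ elements (single x) → w ∉ D → 1 ≤ ω u w → f w ≡ f u → w ∈ elements (single x)
    closed u w (here refl) w∉D ωuw eq = contradiction eq (isolated w w∉D ωuw)
    closed u w (there (here refl)) w∉D ωuw eq = contradiction eq (isolated w w∉D ωuw)
    closed u w (there (there (here refl))) w∉D ωuw eq = contradiction eq (isolated w w∉D ωuw)

  -- Cost at most 1 leaves `x` as the only neighbour of `z` in its colour, so the two form a
  -- component. In `small-triple` the same holds for two leaves.
  small-pair : ∀ {x z D f} → Small (x ∷ D) f →
    (∀ w → 1 ≤ ω x w → f w ≡ f x → w ≡ z) → 1 ≤ ω x z → f z ≡ f x → cost f z (f z) ≤ 1 → Small D f
  small-pair {x} {z} {D} {f} small only-z ωxz fz cost≤1 = small-adjoin small (x , z , z) (here refl) closed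
    where
    from-z : ∀ w → 1 ≤ ω z w → f w ≡ f z → w ∈ elements (x , z , z)
    from-z w ωzw eq = here (same-neighbour f z cost≤1 (neighbour-sym ωxz) (sym fz) ωzw eq)
    closed : ∀ u w → u ∈ elements (x , z , z) → w ∉ D → 1 ≤ ω u w → f w ≡ f u → w ∈ elements (x , z , z)
    closed u w (here refl) w∉D ωuw eq = there (here (only-z w ωuw eq))
    closed u w (there (here refl)) w∉D ωuw eq = from-z w ωuw eq
    closed u w (there (there (here refl))) w∉D ωuw eq = from-z w ωuw eq

  small-triple : ∀ {x y z D f} → Small (x ∷ D) f →
    (∀ w → 1 ≤ ω x w → f w ≡ f x → w ≡ y ⊎ w ≡ z) →
    1 ≤ ω x y → f y ≡ f x → cost f y (f y) ≤ 1 →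
    1 ≤ ω x z → f z ≡ f x → cost f z (f z) ≤ 1 → Small D f
  small-triple {x} {y} {z} {D} {f} small only ωxy fy costy≤1 ωxz fz costz≤1 =
    small-adjoin small (x , y , z) (here refl) closed
    where
    from-x : ∀ {w} → w ≡ y ⊎ w ≡ z → w ∈ elements (x , y , z)
    from-x (inj₁ w≡y) = there (here w≡y)
    from-x (inj₂ w≡z) = there (there (here w≡z))
    closed : ∀ u w → u ∈ elements (x , y , z) → w ∉ D → 1 ≤ ω u w → f w ≡ f u → w ∈ elements (x , y , z)
    closed u w (here refl) w∉D ωuw eq = from-x (only w ωuw eq)
    closed u w (there (here refl)) w∉D ωuw eq =
      here (same-neighbour f y costy≤1 (neighbour-sym ωxy) (sym fy) ωuw eq)
    closed u w (there (there (here refl))) w∉D ωuw eq =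
      here (same-neighbour f z costz≤1 (neighbour-sym ωxz) (sym fz) ωuw eq)

  -- Holes, and moving a hole to a neighbour.

  optimal-cost≤2 : ∀ {f v} → Optimal f → S v ≡ true → cost f v (f v) ≤ 2
  optimal-cost≤2 opt v∈S = ≤-pred (optimal-cost< opt v∈S)

  -- W holds the vertices not yet put back; R holds the vertices fixed on the way to the current hole.
  module Ignoring (W : List (Fin n)) where

    -- A hole has cost exactly 2, the maximum in an optimal colouring, so giving it another list
    -- colour of cost 2 keeps the colouring optimal.
    record State (f : Fin n → ℕ) (v : Fin n) (R : List (Fin n)) : Set where
      field
        optimal : Optimal f
        inside  : S v ≡ true
        fresh   : v ∉ R
        tight   : cost f v (f v) ≡ 2
        small   : Small (v ∷ R ++ W) f

    -- The hole v is filled.  By shrink, no vertex of R gains a neighbour in its colour, and v is not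
    -- such a neighbour any more: this is what lets the last vertex of R be filled next.
    record Result (f : Fin n → ℕ) (v : Fin n) (R : List (Fin n)) : Set where
      field
        colouring : Fin n → ℕ
        optimal   : Optimal colouring
        small     : Small (R ++ W) colouring
        agree     : ∀ w → w ∈ R → colouring w ≡ f w
        shrink    : ∀ w u → w ∈ R → 1 ≤ ω w u → colouring u ≡ colouring w → f u ≡ f w × u ≢ v

    -- Inductive, since a colour of v may be blocked by a vertex of R, which then must be a Hole too.
    data Bad (f : Fin n → ℕ) (v : Fin n) (R : List (Fin n)) : Set where
      bad : State f v R → ¬ Result f v R →
            (∀ w → w ∈ R → ∃ λ f′ → ∃ λ R′ → Bad f′ w R′) → Bad f v R

    Hole : Fin n → Set
    Hole v = ∃ λ f → ∃ λ R → Bad f v R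

    -- With `v` recoloured and put on `R`, `z₁` is the hole. If it cannot be filled, it is a `Hole`.
    -- If it can, `v` would be filled as well, unless `z₂` keeps the colour of `v` and has cost 2.
    -- Then `z₂` is the hole over the same `R`, and filling it would again fill `v`.
    push : ∀ {f v R c z₁ z₂} → Bad f v R → c ∈ L v → cost f v c ≡ 2 →
      1 ≤ ω v z₁ → f z₁ ≡ c → (∀ u → 1 ≤ ω v u → f u ≡ c → u ≡ z₁ ⊎ u ≡ z₂) →
      z₁ ∉ R → z₂ ∉ R → 2 ≤ cost (f [ v ≔ c ]) z₁ ((f [ v ≔ c ]) z₁) → ¬ ¬ (Hole z₁ ⊎ Hole z₂)
    push {f} {v} {R} {c} {z₁} {z₂} (bad state none holes) c∈L costc ωvz₁ fz₁ cover z₁∉R z₂∉R cost₁ neither =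
      ¬¬-excluded-middle λ { (no none′) → neither (inj₁ (fc , v ∷ R , bad state′ none′ holes′))
                           ; (yes result) → popped result }
      where
      open State state
      fc = f [ v ≔ c ]
      optimal-fc : Optimal fc
      optimal-fc = optimal-≔ optimal inside c∈L (trans costc (sym tight))
      z₁≢v : z₁ ≢ v
      z₁≢v = neighbour-≢ (neighbour-sym ωvz₁)
      fc-v : fc v ≡ c
      fc-v = ≔-at f v c
      inside₁ : S z₁ ≡ true
      inside₁ = mono-inside optimal-fc (neighbour-sym ωvz₁)
        (trans fc-v (trans (sym fz₁) (sym (≔-off f z₁≢v))))
      fresh₁ : z₁ ∉ v ∷ R
      fresh₁ (here z₁≡v)   = z₁≢v z₁≡v
      fresh₁ (there z₁∈R)  = z₁∉R z₁∈R
      state′ : State fc z₁ (v ∷ R)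
      state′ = record
        { optimal = optimal-fc
        ; inside  = inside₁
        ; fresh   = fresh₁
        ; tight   = ≤-antisym (optimal-cost≤2 optimal-fc inside₁) cost₁
        ; small   = small-mono there (λ u u∉ → ≔-off f λ u≡v → u∉ (there (here u≡v))) small
        }
      holes′ : ∀ w → w ∈ v ∷ R → Hole w
      holes′ w (here refl) = f , R , bad state none holes
      holes′ w (there w∈R) = holes w w∈R

      popped : Result fc z₁ (v ∷ R) → ⊥
      popped result = done
        where
        open Result result renaming (colouring to f′; optimal to optimal′; small to small′)
        -- By `shrink`, such a neighbour already had colour `c` before the filling and is not `z₁`.
        only-z₂ : ∀ w → 1 ≤ ω v w → f′ w ≡ f′ v → w ≡ z₂
        only-z₂ w ωvw eq with shrink v w (here refl) ωvw eq
        ... | fcw , w≢z₁ with cover w ωvw (trans (sym (≔-off f (neighbour-≢ (neighbour-sym ωvw)))) (trans fcw fc-v))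
        ...   | inj₁ w≡z₁ = contradiction w≡z₁ w≢z₁
        ...   | inj₂ w≡z₂ = w≡z₂
        agree-R : ∀ w → w ∈ R → f′ w ≡ f w
        agree-R w w∈R = trans (agree w (there w∈R)) (≔-off f λ { refl → fresh w∈R })
        shrink-R : ∀ w u → w ∈ R → 1 ≤ ω w u → f′ u ≡ f′ w → f u ≡ f w × u ≢ v
        shrink-R w u w∈R ωwu eq = trans (sym (≔-off f u≢v)) fcu , u≢v
          where
          w≢v : w ≢ v
          w≢v refl = fresh w∈R
          fcu : fc u ≡ f w
          fcu = trans (proj₁ (shrink w u (there w∈R) ωwu eq)) (≔-off f w≢v)
          -- Otherwise `w` is a neighbour of `v` coloured `c`, hence `z₁` or `z₂`, and neither lies
          -- on `R`.
          u≢v : u ≢ v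
          u≢v refl with cover w (neighbour-sym ωwu) (trans (sym fcu) fc-v)
          ... | inj₁ refl = z₁∉R w∈R
          ... | inj₂ refl = z₂∉R w∈R
        finish : Small (R ++ W) f′ → ⊥
        finish s = none (record { colouring = f′ ; optimal = optimal′ ; small = s
                                ; agree = agree-R ; shrink = shrink-R })
        move : z₂ ∉ R ++ W → 1 ≤ ω v z₂ → f′ z₂ ≡ f′ v → 2 ≤ cost f′ z₂ (f′ z₂) → ⊥
        move z₂∉ ωvz₂ fz₂ cost₂ = neither (inj₂ (f′ , R , bad state₂ none₂ holes))
          where
          inside₂ : S z₂ ≡ true
          inside₂ = mono-inside optimal′ (neighbour-sym ωvz₂) (sym fz₂)
          -- Deleting `z₂` too isolates `v` in its colour, so `v` can return and `z₂` takes its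
          -- place.
          without-z₂ : Small (v ∷ z₂ ∷ R ++ W) f′
          without-z₂ = small-mono (λ { (here e) → here e ; (there e) → there (there e) }) (λ _ _ → refl) small′
          state₂ : State f′ z₂ R
          state₂ = record
            { optimal = optimal′
            ; inside  = inside₂
            ; fresh   = z₂∉R
            ; tight   = ≤-antisym (optimal-cost≤2 optimal′ inside₂) cost₂
            ; small   = small-isolated without-z₂ λ w w∉ ωvw eq → w∉ (here (only-z₂ w ωvw eq))
            }
          none₂ : ¬ Result f′ z₂ R
          none₂ result″ = none (record
            { colouring = R₂.colouring
            ; optimal   = R₂.optimal
            ; small     = R₂.small
            ; agree     = λ w w∈R → trans (R₂.agree w w∈R) (agree-R w w∈R)
            ; shrink    = λ w u w∈R ωwu eq → shrink-R w u w∈R ωwu (proj₁ (R₂.shrink w u w∈R ωwu eq))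
            })
            where module R₂ = Result result″
        done : ⊥
        done with 1 ≤? ω v z₂ | f′ z₂ ≟ f′ v
        ... | no  ω≱1 | _        = finish (small-isolated small′ λ w _ ωvw eq →
          ω≱1 (subst (λ z → 1 ≤ ω v z) (only-z₂ w ωvw eq) ωvw))
        ... | yes _   | no  fz₂≢ = finish (small-isolated small′ λ w _ ωvw eq →
          fz₂≢ (subst (λ z → f′ z ≡ f′ v) (only-z₂ w ωvw eq) eq))
        ... | yes ωvz₂ | yes fz₂ with z₂ ∈? R ++ W | 2 ≤? cost f′ z₂ (f′ z₂)
        -- `z₂` is itself still deleted, so `v` meets no remaining neighbour in its colour.
        ...   | yes z₂∈ | _ = finish (small-isolated small′ λ w w∉ ωvw eq →
          w∉ (subst (_∈ R ++ W) (sym (only-z₂ w ωvw eq)) z₂∈))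
        ...   | no  _   | no cost≱2 = finish (small-pair small′ only-z₂ ωvz₂ fz₂ (≤-pred (≰⇒> cost≱2)))
        ...   | no  z₂∉ | yes cost≥2 = move z₂∉ ωvz₂ fz₂ cost≥2

    -- Suppose neither neighbour coloured `c` is a hole; then neither lies on `R`. If one of them
    -- has cost 2 after `v` takes colour `c`, `push` turns one into a hole. If both have cost at
    -- most 1, they form a three-vertex component with `v`, and `v` is filled.
    hole-neighbour : ∀ {f v R c} → Bad f v R → c ∈ L v → cost f v c ≡ 2 →
      ¬ ¬ ∃ λ u → Hole u × 1 ≤ ω v u × f u ≡ c
    hole-neighbour {f} {v} {R} {c} b@(bad state none holes) c∈L costc absent
      with support-two (λ u → ω v u * 𝟙 (f u ≟ c)) costc
    ... | z₁ , z₂ , pos₁ , pos₂ , cover′ = search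
      where
      open State state
      fc = f [ v ≔ c ]
      nb₁ = weighted-indicator (f z₁ ≟ c) pos₁
      nb₂ = weighted-indicator (f z₂ ≟ c) pos₂
      cover : ∀ u → 1 ≤ ω v u → f u ≡ c → u ≡ z₁ ⊎ u ≡ z₂
      cover u ωvu fu = cover′ u (≤-trans ωvu (weighted-indicator⁻¹ (f u ≟ c) fu))
      swap-cover : ∀ u → 1 ≤ ω v u → f u ≡ c → u ≡ z₂ ⊎ u ≡ z₁
      swap-cover u ωvu fu = [ inj₂ , inj₁ ] (cover u ωvu fu)
      found₁ : ¬ Hole z₁
      found₁ hole = absent (z₁ , hole , nb₁)
      found₂ : ¬ Hole z₂
      found₂ hole = absent (z₂ , hole , nb₂)
      fc-v : fc v ≡ c
      fc-v = ≔-at f v c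
      fc-nb : ∀ {z} → 1 ≤ ω v z × f z ≡ c → fc z ≡ fc v
      fc-nb (ωvz , fz) = trans (≔-off f (neighbour-≢ (neighbour-sym ωvz))) (trans fz (sym fc-v))
      cheap : cost fc z₁ (fc z₁) ≤ 1 → cost fc z₂ (fc z₂) ≤ 1 → ⊥
      cheap cost₁ cost₂ = none (record
        { colouring = fc
        ; optimal   = optimal-≔ optimal inside c∈L (trans costc (sym tight))
        ; small     = small-triple (small-mono (λ e → e) (λ u u∉ → ≔-off f λ u≡v → u∉ (here u≡v)) small)
                        (λ w ωvw eq → cover w ωvw (trans (sym (≔-off f (neighbour-≢ (neighbour-sym ωvw)))) (trans eq fc-v)))
                        (proj₁ nb₁) (fc-nb nb₁) cost₁ (proj₁ nb₂) (fc-nb nb₂) cost₂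
        ; agree     = λ w w∈R → ≔-off f λ { refl → fresh w∈R }
        ; shrink    = shrink
        })
        where
        shrink : ∀ w u → w ∈ R → 1 ≤ ω w u → fc u ≡ fc w → f u ≡ f w × u ≢ v
        shrink w u w∈R ωwu eq = trans (sym (≔-off f u≢v)) fcu , u≢v
          where
          fcu : fc u ≡ f w
          fcu = trans eq (≔-off f λ { refl → fresh w∈R })
          -- Otherwise `w` is `z₁` or `z₂`, and lying on `R` it would be a hole, contrary to
          -- `absent`.
          u≢v : u ≢ v
          u≢v refl with cover w (neighbour-sym ωwu) (trans (sym fcu) fc-v)
          ... | inj₁ refl = found₁ (holes w w∈R)
          ... | inj₂ refl = found₂ (holes w w∈R)
      search : ⊥
      search with 2 ≤? cost fc z₁ (fc z₁) | 2 ≤? cost fc z₂ (fc z₂)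
      ... | yes cost₁ | _ = push b c∈L costc (proj₁ nb₁) (proj₂ nb₁) cover
                              (found₁ ∘ holes z₁) (found₂ ∘ holes z₂) cost₁ [ found₁ , found₂ ]
      ... | no _ | yes cost₂ = push b c∈L costc (proj₁ nb₂) (proj₂ nb₂) swap-cover
                              (found₂ ∘ holes z₂) (found₁ ∘ holes z₁) cost₂ [ found₂ , found₁ ]
      ... | no cost₁ | no cost₂ = cheap (≤-pred (≰⇒> cost₁)) (≤-pred (≰⇒> cost₂))

    -- Holes contradict sparsity.

    module _ (X : Fin n → Bool) (complete : ∀ {v} → Hole v → X v ≡ true) where

      -- By optimality `c` costs at least 2 at `v`. At cost exactly 2, the edge to the hole found by
      -- `hole-neighbour` counts twice and supplies the third unit. The double negation disappears
      -- because the inequality is decidable.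
      colour-degree : ∀ {f v R} → Bad f v R → ∀ c → c ∈ L v →
        3 ≤ sum (λ u → (ω v u + ⟦ X u ⟧ * ω v u) * 𝟙 (f u ≟ c))
      colour-degree {f} {v} b@(bad state _ _) c c∈L = decidable-stable (3 ≤? _) λ low → go low
        where
        open State state
        a : Fin n → ℕ
        a u = ω v u * 𝟙 (f u ≟ c)
        total : Fin n → ℕ
        total u = (ω v u + ⟦ X u ⟧ * ω v u) * 𝟙 (f u ≟ c)
        a≤total : ∀ u → a u ≤ total u
        a≤total u = *-monoˡ-≤ (𝟙 (f u ≟ c)) (m≤m+n (ω v u) (⟦ X u ⟧ * ω v u))
        cost≥2 : 2 ≤ cost f v c
        cost≥2 = ≤-trans (≤-reflexive (sym tight)) (optimal-cost≤ optimal inside c∈L)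
        go : ¬ 3 ≤ sum total → ⊥
        go low with 3 ≤? cost f v c
        ... | yes cost≥3 = low (≤-trans cost≥3 (sum-mono-≤ a≤total))
        ... | no  cost≱3 = hole-neighbour b c∈L costc λ (u , hole , ωvu , fu) →
          low (≤-trans (s≤s (≤-reflexive (sym costc))) (sum-strict-≤ a≤total u (doubled u (complete hole) ωvu fu)))
          where
          costc : cost f v c ≡ 2
          costc = ≤-antisym (≤-pred (≰⇒> cost≱3)) cost≥2
          doubled : ∀ u → X u ≡ true → 1 ≤ ω v u → f u ≡ c → a u < total u
          doubled u Xu ωvu fu rewrite Xu | 𝟙-yes (f u ≟ c) fu
            | *-identityʳ (ω v u) | *-identityʳ (ω v u + (ω v u + 0)) | +-identityʳ (ω v u) =
            m<m+n (ω v u) ωvu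

      hole-degree : ∀ {v} → Hole v → q * 3 ≤ sum (λ u → ω v u + ⟦ X u ⟧ * ω v u)
      hole-degree {v} (f , _ , b) = ≤-trans (*-monoˡ-≤ 3 (L-large v))
        (colour-bound 3 _ f (L-unique v) (colour-degree b))

    -- The Boolean set of all holes exists only up to double negation, which suffices for a
    -- contradiction: `hole-degree` summed over it violates `sparse`.
    no-hole : ∀ {v} → ¬ Hole v
    no-hole {v} hole = ¬¬-decide Hole λ hole? → absurd hole?
      where
      absurd : (∀ v → Dec (Hole v)) → ⊥
      absurd hole? = <⇒≱ (sparse X inside v (complete hole)) (sum-mono-≤ bound)
        where
        X : Fin n → Bool
        X u with hole? u
        ... | yes _ = true
        ... | no  _ = false
        complete : ∀ {u} → Hole u → X u ≡ true
        complete {u} h with hole? u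
        ... | yes _ = refl
        ... | no ¬h = contradiction h ¬h
        sound : ∀ u → X u ≡ true → Hole u
        sound u Xu with hole? u
        ... | yes h = h
        inside : ∀ u → X u ≡ true → S u ≡ true
        inside u Xu with sound u Xu
        ... | _ , _ , bad state _ _ = State.inside state
        bound : ∀ u → ⟦ X u ⟧ * (q * 3) ≤ ⟦ X u ⟧ * sum (λ w → ω u w + ⟦ X w ⟧ * ω u w)
        bound u with X u in Xu
        ... | false = z≤n
        ... | true  = *-monoʳ-≤ 1 (hole-degree X complete (sound u Xu))

    resolve : ∀ {f v} → State f v [] → ¬ ¬ ∃ λ f′ → Optimal f′ × Small W f′
    resolve {f} {v} state none = no-hole (f , [] , bad state
      (λ result → none (_ , Result.optimal result , Result.small result)) λ w ())

  -- At cost 0 the vertex `x` returns alone, and at cost 2 it is the first hole. At cost 1, with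
  -- neighbour `z` in its colour, it returns with `z` as a pair if `z` is cheap; otherwise `z` is
  -- the first hole in its place.
  small-step : ∀ {f x W} → Optimal f → Small (x ∷ W) f → ¬ ¬ ∃ λ f′ → Optimal f′ × Small W f′
  small-step {f} {x} {W} opt small none with 1 ≤? cost f x (f x)
  ... | no cost≱1 = none (f , opt , small-isolated small λ w _ ωxw eq →
          cost≱1 (≤-trans ωxw (ω≤cost f x (f x) w eq)))
  ... | yes cost≥1 with sum-positive (λ u → ω x u * 𝟙 (f u ≟ f x)) cost≥1
  ...   | z , pos with weighted-indicator (f z ≟ f x) pos
  ...     | ωxz , fz = isolated-or-move
    where
    open Ignoring W
    x∈S : S x ≡ true
    x∈S = mono-inside opt ωxz fz
    z∈S : S z ≡ true
    z∈S = mono-inside opt (neighbour-sym ωxz) (sym fz)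
    isolated-or-move : ⊥
    isolated-or-move with 2 ≤? cost f x (f x)
    ... | yes cost≥2 = resolve (record
            { optimal = opt ; inside = x∈S ; fresh = λ ()
            ; tight = ≤-antisym (optimal-cost≤2 opt x∈S) cost≥2 ; small = small }) none
    ... | no cost≱2 with 2 ≤? cost f z (f z)
    ...   | no cost-z = none (f , opt , small-pair small only-z ωxz fz (≤-pred (≰⇒> cost-z)))
      where
      only-z : ∀ w → 1 ≤ ω x w → f w ≡ f x → w ≡ z
      only-z w ωxw eq = same-neighbour f x (≤-pred (≰⇒> cost≱2)) ωxz fz ωxw eq
    ...   | yes cost-z = resolve (record
            { optimal = opt ; inside = z∈S ; fresh = λ ()
            ; tight = ≤-antisym (optimal-cost≤2 opt z∈S) cost-z
            ; small = small-isolated (small-mono (λ { (here e) → here e ; (there e) → there (there e) }) (λ _ _ → refl) small)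
                λ w w∉ ωxw eq → w∉ (here (same-neighbour f x (≤-pred (≰⇒> cost≱2)) ωxz fz ωxw eq)) }) none

  ¬¬-small : (∀ v → g v ∈ L v) → ¬ ¬ ∃ λ f → Optimal f × Small [] f
  ¬¬-small g∈L none = ¬¬-optimal g∈L λ (f , opt) → shrink (allFin n) opt
      -- While every vertex is deleted, the closure condition is vacuous and any blocks will do.
      (single , (λ _ → here refl) , λ u w u∉ → contradiction (∈-allFin u) u∉)
    where
    shrink : ∀ W {f} → Optimal f → ¬ Small W f
    shrink []      {f} opt small = none (f , opt , small)
    shrink (x ∷ W) opt small = small-step opt small λ (f′ , opt′ , small′) → shrink W opt′ small′

-- Vertex sets, edge counts between them, and edge weights.

_∖_ : ∀ {n} → (Fin n → Bool) → (Fin n → Bool) → Fin n → Bool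
(U ∖ S) v = U v ∧ not (S v)

_⊆ᵇ_ : ∀ {n} → (Fin n → Bool) → (Fin n → Bool) → Set
X ⊆ᵇ S = ∀ v → X v ≡ true → S v ≡ true

card : ∀ {n} → (Fin n → Bool) → ℕ
card X = sum λ v → ⟦ X v ⟧

∖-split : ∀ {n} {X S : Fin n → Bool} → X ⊆ᵇ S → ∀ v → ⟦ S v ⟧ ≡ ⟦ (S ∖ X) v ⟧ + ⟦ X v ⟧
∖-split {X = X} {S} X⊆S v with X v in Xv | S v in Sv
... | true  | true  = refl
... | true  | false with () ← trans (sym (X⊆S v Xv)) Sv
... | false | true  = refl
... | false | false = refl

card-split : ∀ {n} {X S : Fin n → Bool} → X ⊆ᵇ S → card S ≡ card (S ∖ X) + card X
card-split {X = X} {S} X⊆S = trans (sum-cong-≗ (∖-split X⊆S)) (∑-distrib-+ (λ v → ⟦ (S ∖ X) v ⟧) (λ v → ⟦ X v ⟧))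

card-positive : ∀ {n} {X : Fin n → Bool} v → X v ≡ true → 1 ≤ card X
card-positive {X = X} v Xv = ≤-trans (≤-reflexive (cong ⟦_⟧ (sym Xv))) (term≤sum (λ v → ⟦ X v ⟧) v)

card-∖< : ∀ {n} {X S : Fin n → Bool} → X ⊆ᵇ S → ∀ v → X v ≡ true → card (S ∖ X) < card S
card-∖< {X = X} {S} X⊆S v Xv = ≤-trans (m<m+n (card (S ∖ X)) (card-positive v Xv)) (≤-reflexive (sym (card-split X⊆S)))

module Pairs {n : ℕ} (adj : Fin n → Fin n → Bool) (adj-sym : ∀ u v → adj u v ≡ adj v u) where

  degree : (Fin n → Bool) → Fin n → ℕ
  degree Y v = sum λ u → ⟦ Y u ⟧ * ⟦ adj v u ⟧

  -- These are ordered adjacent pairs: `pairs X X` is twice the number of edges inside `X`.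
  pairs : (Fin n → Bool) → (Fin n → Bool) → ℕ
  pairs X Y = sum λ v → ⟦ X v ⟧ * degree Y v

  pairs-comm : ∀ X Y → pairs X Y ≡ pairs Y X
  pairs-comm X Y = begin
    pairs X Y                                               ≡⟨ sum-cong-≗ (λ v → *-distribˡ-sum ⟦ X v ⟧ (λ u → ⟦ Y u ⟧ * ⟦ adj v u ⟧)) ⟩
    sum (λ v → sum (λ u → ⟦ X v ⟧ * (⟦ Y u ⟧ * ⟦ adj v u ⟧)))  ≡⟨ ∑-comm (λ v u → ⟦ X v ⟧ * (⟦ Y u ⟧ * ⟦ adj v u ⟧)) ⟩
    sum (λ u → sum (λ v → ⟦ X v ⟧ * (⟦ Y u ⟧ * ⟦ adj v u ⟧)))  ≡⟨ sum-cong-≗ (λ u → sum-cong-≗ (λ v → swap u v)) ⟩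
    sum (λ u → sum (λ v → ⟦ Y u ⟧ * (⟦ X v ⟧ * ⟦ adj u v ⟧)))  ≡⟨ sum-cong-≗ (λ u → *-distribˡ-sum ⟦ Y u ⟧ (λ v → ⟦ X v ⟧ * ⟦ adj u v ⟧)) ⟨
    pairs Y X                                               ∎
    where
    open ≡-Reasoning
    exchange : ∀ x y z → x * (y * z) ≡ y * (x * z)
    exchange = solve-∀
    swap : ∀ u v → ⟦ X v ⟧ * (⟦ Y u ⟧ * ⟦ adj v u ⟧) ≡ ⟦ Y u ⟧ * (⟦ X v ⟧ * ⟦ adj u v ⟧)
    swap u v = trans (exchange ⟦ X v ⟧ ⟦ Y u ⟧ _) (cong (λ b → ⟦ Y u ⟧ * (⟦ X v ⟧ * ⟦ b ⟧)) (adj-sym v u))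

  pairs-splitˡ : ∀ {X S} → X ⊆ᵇ S → ∀ Y → pairs S Y ≡ pairs (S ∖ X) Y + pairs X Y
  pairs-splitˡ {X} {S} X⊆S Y = trans (sum-cong-≗ term)
      (∑-distrib-+ (λ v → ⟦ (S ∖ X) v ⟧ * degree Y v) (λ v → ⟦ X v ⟧ * degree Y v))
    where
    term : ∀ v → ⟦ S v ⟧ * degree Y v ≡ ⟦ (S ∖ X) v ⟧ * degree Y v + ⟦ X v ⟧ * degree Y v
    term v = trans (cong (_* degree Y v) (∖-split X⊆S v)) (*-distribʳ-+ (degree Y v) ⟦ (S ∖ X) v ⟧ ⟦ X v ⟧)

  pairs-splitʳ : ∀ {X S} → X ⊆ᵇ S → ∀ Y → pairs Y S ≡ pairs Y (S ∖ X) + pairs Y X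
  pairs-splitʳ {X} {S} X⊆S Y = trans (pairs-comm Y S) (trans (pairs-splitˡ X⊆S Y)
    (cong₂ _+_ (pairs-comm (S ∖ X) Y) (pairs-comm X Y)))

  module Weights (t : ℕ) (U S : Fin n → Bool) (S⊆U : S ⊆ᵇ U) where

    -- Edges with no end in `S`, or with an end outside `U`, get weight 0: the former are left to
    -- `g`, the latter to later stages.
    ω : Fin n → Fin n → ℕ
    ω v u = ⟦ adj v u ⟧ * (⟦ S v ⟧ * ⟦ S u ⟧ +
      suc t * (⟦ S v ⟧ * ⟦ (U ∖ S) u ⟧ + ⟦ (U ∖ S) v ⟧ * ⟦ S u ⟧))

    ω-sym : ∀ u v → ω u v ≡ ω v u
    ω-sym u v = trans (cong (λ b → ⟦ b ⟧ * _) (adj-sym u v))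
      (cong (⟦ adj v u ⟧ *_) (commute ⟦ S u ⟧ ⟦ S v ⟧ ⟦ (U ∖ S) v ⟧ ⟦ (U ∖ S) u ⟧ t))
      where
      commute : ∀ a b c d t → a * b + suc t * (a * c + d * b) ≡ b * a + suc t * (b * d + c * a)
      commute = solve-∀

    ω-row : ∀ v → S v ≡ true → ∀ u → ω v u ≡ ⟦ S u ⟧ * ⟦ adj v u ⟧ + suc t * (⟦ (U ∖ S) u ⟧ * ⟦ adj v u ⟧)
    ω-row v Sv u rewrite Sv | S⊆U v Sv = simplify ⟦ adj v u ⟧ ⟦ S u ⟧ ⟦ (U ∖ S) u ⟧ t
      where
      simplify : ∀ a s y t → a * (1 * s + suc t * (1 * y + 0 * s)) ≡ s * a + suc t * (y * a)
      simplify = solve-∀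

    ω-inside : ∀ v u → S v ≡ true → S u ≡ true → ω v u ≡ ⟦ adj v u ⟧
    ω-inside v u Sv Su rewrite Sv | Su | S⊆U v Sv | S⊆U u Su = simplify ⟦ adj v u ⟧ t
      where
      simplify : ∀ a t → a * (1 * 1 + suc t * (1 * 0 + 0 * 1)) ≡ a
      simplify = solve-∀

    ω-positive : ∀ v u → S v ≡ true → ⟦ U u ⟧ * ⟦ adj v u ⟧ ≤ ω v u
    ω-positive v u Sv rewrite ω-row v Sv u with S u | U u
    ... | _     | false = z≤n
    ... | true  | true  = m≤m+n _ _
    ... | false | true  = m≤m+n _ _

    boundary : ∀ u v → S u ≡ false → 1 ≤ ω u v → S v ≡ true × suc t ≤ ω u v
    boundary u v Su pos rewrite Su with adj u v | S v | U u
    ... | true | true  | true  = refl , ≤-reflexive (simplify t)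
      where
      simplify : ∀ t → suc t ≡ 1 * (0 * 1 + suc t * (0 * 0 + 1 * 1))
      simplify = solve-∀
    ... | false | _ | _ with () ← pos
    ... | true | true | false = contradiction pos λ p → <⇒≱ (s≤s z≤n) (≤-trans p (≤-reflexive (vanish t)))
      where
      vanish : ∀ t → 1 * (0 * 1 + suc t * (0 * 0 + 0 * 1)) ≡ 0
      vanish = solve-∀
    ... | true | false | b = contradiction pos λ p → <⇒≱ (s≤s z≤n) (≤-trans p (≤-reflexive (vanish t ⟦ U v ∧ true ⟧ ⟦ b ∧ true ⟧)))
      where
      vanish : ∀ t x y → 1 * (0 * 0 + suc t * (0 * x + y * 0)) ≡ 0
      vanish = solve-∀

-- Smallest dense sets and the sparsity of their subsets.

module Selection {n : ℕ} (adj : Fin n → Fin n → Bool) (adj-sym : ∀ u v → adj u v ≡ adj v u)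
  (q t : ℕ) (U : Fin n → Bool) where

  open Pairs adj adj-sym

  -- Twice the inequality (t + 1) Σ_{v ∈ S} (q - deg_U v) + t e(S) > 0, with no subtraction;
  -- it holds for S = U by the edge bound and fails for S = ∅.
  Dense : (Fin n → Bool) → Set
  Dense S = S ⊆ᵇ U × 2 * suc t * pairs S U < t * pairs S S + 2 * suc t * q * card S

  Critical : (Fin n → Bool) → Set
  Critical S = Dense S × (∀ S′ → Dense S′ → card S ≤ card S′)

  ¬¬-critical : (2 + t) * pairs U U < 2 * suc t * q * card U → ¬ ¬ ∃ Critical
  ¬¬-critical few = ¬¬-minimal Dense card (U , (λ _ Uv → Uv) ,
    subst (_< t * p + 2 * suc t * q * card U) (double t p) (+-monoʳ-< (t * p) few))
    where
    p = pairs U U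
    double : ∀ t p → t * p + (2 + t) * p ≡ 2 * suc t * p
    double = solve-∀

  critical-nonempty : ∀ {S} → Critical S → ∃ λ v → S v ≡ true
  critical-nonempty {S} ((_ , dense) , _) with 1 ≤? card S
  ... | no  empty = contradiction dense (≤⇒≯ (≤-trans (≤-reflexive vanish) z≤n))
    where
    S≡0 : ∀ v → ⟦ S v ⟧ ≡ 0
    S≡0 v = n≤0⇒n≡0 (≤-trans (term≤sum (λ v → ⟦ S v ⟧) v) (≤-pred (≰⇒> empty)))
    zero-pairs : pairs S S ≡ 0
    zero-pairs = sum-zero λ v → cong (_* degree S v) (S≡0 v)
    vanish : t * pairs S S + 2 * suc t * q * card S ≡ 0
    vanish = cong₂ _+_ (trans (cong (t *_) zero-pairs) (*-zeroʳ t))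
               (trans (cong (2 * suc t * q *_) (sum-zero S≡0)) (*-zeroʳ (2 * suc t * q)))
  ... | yes pos with sum-positive (λ v → ⟦ S v ⟧) pos
  ...   | v , pos′ with S v in Sv
  ...     | true = v , Sv

  module _ {S : Fin n → Bool} (critical : Critical S) where

    S⊆U : S ⊆ᵇ U
    S⊆U = proj₁ (proj₁ critical)

    open Weights t U S S⊆U

    -- Removing the nonempty `X` from `S` leaves a smaller set `S′`, which by minimality is not
    -- dense (`light`). Comparing this with the density of `S` gives the inequality for `X`; a
    -- common summand, added on both sides and then cancelled, replaces subtraction.
    sparse : ∀ X → X ⊆ᵇ S → ∀ v → X v ≡ true →
      2 * sum (λ v → ⟦ X v ⟧ * sum (ω v)) + t * sum (λ v → ⟦ X v ⟧ * sum (λ u → ⟦ X u ⟧ * ω v u))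
        < 2 * sum (λ v → ⟦ X v ⟧ * (q * suc t))
    sparse X X⊆S v₀ Xv₀ = begin-strict
      2 * sum (λ v → ⟦ X v ⟧ * sum (ω v)) + t * sum (λ v → ⟦ X v ⟧ * sum (λ u → ⟦ X u ⟧ * ω v u))
        ≡⟨ cong₂ (λ c d → 2 * c + t * d) rows squares ⟩
      2 * ((r + x) + suc t * y) + t * x
        <⟨ +-cancelˡ-< (2 * suc t * a + 2 * t * r + t * x) _ _ shifted ⟩
      2 * (card X * (q * suc t))
        ≡⟨ cong (2 *_) (*-distribʳ-sum (q * suc t) (λ v → ⟦ X v ⟧)) ⟩
      2 * sum (λ v → ⟦ X v ⟧ * (q * suc t)) ∎
      where
      open ≤-Reasoning
      S′ = S ∖ X
      a = pairs S′ U
      p = pairs S′ S′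
      -- `r`, `x` and `y` split the pairs starting in `X` by their other end: in `S′`, in `X`, or in
      -- `U` outside `S`.
      r = pairs X S′
      x = pairs X X
      y = pairs X (U ∖ S)
      X-S : pairs X S ≡ r + x
      X-S = pairs-splitʳ X⊆S X
      S-U : pairs S U ≡ a + ((r + x) + y)
      S-U = trans (pairs-splitˡ X⊆S U)
        (cong (a +_) (trans (pairs-splitʳ S⊆U X) (trans (+-comm y _) (cong (_+ y) X-S))))
      S-S : pairs S S ≡ (p + r) + (r + x)
      S-S = trans (pairs-splitˡ X⊆S S)
        (cong₂ _+_ (trans (pairs-splitʳ X⊆S S′) (cong (p +_) (pairs-comm S′ X))) X-S)
      S′⊆U : S′ ⊆ᵇ U
      S′⊆U v S′v with S v in Sv
      ... | true = S⊆U v Sv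
      light : t * p + 2 * suc t * q * card S′ ≤ 2 * suc t * a
      light = ≮⇒≥ λ dense → <⇒≱ (card-∖< X⊆S v₀ Xv₀) (proj₂ critical S′ (S′⊆U , dense))
      shifted : (2 * suc t * a + 2 * t * r + t * x) + (2 * ((r + x) + suc t * y) + t * x)
              < (2 * suc t * a + 2 * t * r + t * x) + 2 * (card X * (q * suc t))
      shifted = begin-strict
        (2 * suc t * a + 2 * t * r + t * x) + (2 * ((r + x) + suc t * y) + t * x)
          ≡⟨ left t a r x y ⟩
        2 * suc t * (a + ((r + x) + y))
          ≡⟨ cong (2 * suc t *_) S-U ⟨
        2 * suc t * pairs S U
          <⟨ proj₂ (proj₁ critical) ⟩
        t * pairs S S + 2 * suc t * q * card S
          ≡⟨ cong₂ (λ c d → t * c + 2 * suc t * q * d) S-S (card-split X⊆S) ⟩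
        t * ((p + r) + (r + x)) + 2 * suc t * q * (card S′ + card X)
          ≡⟨ right t q p r x (card S′) (card X) ⟩
        (t * p + 2 * suc t * q * card S′) + (2 * t * r + t * x + 2 * (card X * (q * suc t)))
          ≤⟨ +-monoˡ-≤ _ light ⟩
        2 * suc t * a + (2 * t * r + t * x + 2 * (card X * (q * suc t)))
          ≡⟨ reassociate (2 * suc t * a) (2 * t * r) (t * x) _ ⟩
        (2 * suc t * a + 2 * t * r + t * x) + 2 * (card X * (q * suc t)) ∎
        where
        left : ∀ t a r x y → (2 * suc t * a + 2 * t * r + t * x) + (2 * ((r + x) + suc t * y) + t * x)
                           ≡ 2 * suc t * (a + ((r + x) + y))
        left = solve-∀
        right : ∀ t q p r x c d → t * ((p + r) + (r + x)) + 2 * suc t * q * (c + d)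
                                ≡ (t * p + 2 * suc t * q * c) + (2 * t * r + t * x + 2 * (d * (q * suc t)))
        right = solve-∀
        reassociate : ∀ a b c d → a + (b + c + d) ≡ (a + b + c) + d
        reassociate = solve-∀
      rows : sum (λ v → ⟦ X v ⟧ * sum (ω v)) ≡ (r + x) + suc t * y
      rows = trans (sum-cong-≗ row)
        (trans (∑-distrib-+ (λ v → ⟦ X v ⟧ * degree S v) (λ v → suc t * (⟦ X v ⟧ * degree (U ∖ S) v)))
          (cong₂ _+_ X-S (sym (*-distribˡ-sum (suc t) (λ v → ⟦ X v ⟧ * degree (U ∖ S) v)))))
        where
        row : ∀ v → ⟦ X v ⟧ * sum (ω v) ≡ ⟦ X v ⟧ * degree S v + suc t * (⟦ X v ⟧ * degree (U ∖ S) v)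
        row v with X v in Xv
        ... | false = sym (*-zeroʳ (suc t))
        ... | true  = trans (+-identityʳ _) (trans (sum-cong-≗ (ω-row v (X⊆S v Xv)))
          (trans (∑-distrib-+ (λ u → ⟦ S u ⟧ * ⟦ adj v u ⟧) (λ u → suc t * (⟦ (U ∖ S) u ⟧ * ⟦ adj v u ⟧)))
            (cong₂ _+_ (sym (+-identityʳ _))
              (trans (sym (*-distribˡ-sum (suc t) (λ u → ⟦ (U ∖ S) u ⟧ * ⟦ adj v u ⟧)))
                (cong (suc t *_) (sym (+-identityʳ _)))))))
      squares : sum (λ v → ⟦ X v ⟧ * sum (λ u → ⟦ X u ⟧ * ω v u)) ≡ x
      squares = sum-cong-≗ outer
        where
        outer : ∀ v → ⟦ X v ⟧ * sum (λ u → ⟦ X u ⟧ * ω v u) ≡ ⟦ X v ⟧ * sum (λ u → ⟦ X u ⟧ * ⟦ adj v u ⟧)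
        outer v with X v in Xv
        ... | false = refl
        ... | true  = cong (1 *_) (sum-cong-≗ inner)
          where
          inner : ∀ u → ⟦ X u ⟧ * ω v u ≡ ⟦ X u ⟧ * ⟦ adj v u ⟧
          inner u with X u in Xu
          ... | false = refl
          ... | true  = cong (1 *_) (ω-inside v u (X⊆S v Xv) (X⊆S u Xu))

    -- The case of `sparse` in which `X` is the single vertex `v`, with the second summand dropped.
    degree< : ∀ v → S v ≡ true → sum (ω v) < q * suc t
    degree< v Sv = *-cancelˡ-< 2 _ _ (begin-strict
      2 * sum (ω v)                                          ≡⟨ cong (2 *_) (only (sum ∘ ω)) ⟨
      2 * sum (λ u → ⟦ X u ⟧ * sum (ω u))                    ≤⟨ m≤m+n _ _ ⟩
      2 * sum (λ u → ⟦ X u ⟧ * sum (ω u)) + t * sum (λ u → ⟦ X u ⟧ * sum (λ w → ⟦ X w ⟧ * ω u w))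
                                                             <⟨ sparse X X⊆S v Xv ⟩
      2 * sum (λ u → ⟦ X u ⟧ * (q * suc t))                  ≡⟨ cong (2 *_) (only (λ _ → q * suc t)) ⟩
      2 * (q * suc t)                                        ∎)
      where
      open ≤-Reasoning
      X : Fin n → Bool
      X u with u F.≟ v
      ... | yes _ = true
      ... | no  _ = false
      X⊆S : X ⊆ᵇ S
      X⊆S u Xu with u F.≟ v
      ... | yes refl = Sv
      Xv : X v ≡ true
      Xv with v F.≟ v
      ... | yes _  = refl
      ... | no v≢v = contradiction refl v≢v
      only : (h : Fin n → ℕ) → sum (λ u → ⟦ X u ⟧ * h u) ≡ h v
      only h = trans (sum-cong-≗ indicator) (sum-𝟙 v h)
        where
        indicator : ∀ u → ⟦ X u ⟧ * h u ≡ 𝟙 (u F.≟ v) * h u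
        indicator u with u F.≟ v
        ... | yes _ = refl
        ... | no  _ = refl

-- Edge density of queue layouts.

-- Summing by key first, each of the `M` keys is hit by at most one pair.
sum-keys : ∀ {n} (b key : Fin n → Fin n → ℕ) (M : ℕ) → (∀ u v → b u v ≤ 1) →
  (∀ u v → 1 ≤ b u v → key u v < M) →
  (∀ u v x y → 1 ≤ b u v → 1 ≤ b x y → key u v ≡ key x y → u ≡ x × v ≡ y) →
  sum (λ u → sum (b u)) ≤ M
sum-keys {n} b key M b≤1 key<M key-inj = begin
  sum (λ u → sum (λ v → b u v))                    ≤⟨ sum-mono-≤ (λ u → sum-mono-≤ (expand u)) ⟩
  sum (λ u → sum (λ v → sum (λ s → hit s u v)))    ≡⟨ sum-cong-≗ (λ u → ∑-comm (λ v s → hit s u v)) ⟩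
  sum (λ u → sum (λ s → sum (λ v → hit s u v)))    ≡⟨ ∑-comm (λ u s → sum (λ v → hit s u v)) ⟩
  sum (λ s → sum (λ u → sum (λ v → hit s u v)))    ≤⟨ sum-mono-≤ once ⟩
  sum {M} (λ _ → 1)                                ≡⟨ trans (sum-const M 1) (*-identityʳ M) ⟩
  M                                                ∎
  where
  open ≤-Reasoning
  hit : Fin M → Fin n → Fin n → ℕ
  hit s u v = b u v * 𝟙 (key u v ≟ F.toℕ s)
  expand : ∀ u v → b u v ≤ sum (λ s → hit s u v)
  expand u v with 1 ≤? b u v
  ... | no  b≱1 = ≤-trans (≤-pred (≰⇒> b≱1)) z≤n
  ... | yes b≥1 = ≤-trans (weighted-indicator⁻¹ (key u v ≟ F.toℕ s) (sym (toℕ-fromℕ< (key<M u v b≥1))))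
                          (term≤sum (λ s → hit s u v) s)
    where
    s = F.fromℕ< (key<M u v b≥1)
  hit≤1 : ∀ s u v → hit s u v ≤ 1
  hit≤1 s u v with key u v ≟ F.toℕ s
  ... | yes _ = ≤-trans (≤-reflexive (*-identityʳ _)) (b≤1 u v)
  ... | no  _ = ≤-trans (≤-reflexive (*-zeroʳ (b u v))) z≤n
  same : ∀ s {u v x y} → 1 ≤ hit s u v → 1 ≤ hit s x y → u ≡ x × v ≡ y
  same s {u} {v} {x} {y} p p′ with weighted-indicator (key u v ≟ F.toℕ s) p
                                 | weighted-indicator (key x y ≟ F.toℕ s) p′
  ... | b≥1 , key≡ | b′≥1 , key′≡ = key-inj u v x y b≥1 b′≥1 (trans key≡ (sym key′≡))
  once : ∀ s → sum (λ u → sum (λ v → hit s u v)) ≤ 1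
  once s = sum-at-most-one _
    (λ u → sum-at-most-one _ (hit≤1 s u) λ i j p p′ → proj₂ (same s p p′))
    λ u x p p′ → let (v , h) = sum-positive (hit s u) p ; (y , h′) = sum-positive (hit s x) p′
                 in proj₁ (same s h h′)

module Density {k : ℕ} {G : Graph} (layout : QueueLayout k G) (U : Fin (n G) → Bool) where

  open QueueLayout layout
  open Pairs (adj G) (Graph.sym G)

  position : Fin (n G) → ℕ
  position v = F.toℕ (pos v)

  position-injective : ∀ {u v} → position u ≡ position v → u ≡ v
  position-injective = pos-inj ∘ toℕ-injective

  -- The position counted among the vertices of `U` only, so that the edge bound depends on `card U`
  -- and not on the whole graph.
  rank : Fin (n G) → ℕ
  rank v = sum λ w → ⟦ U w ⟧ * 𝟙 (position w <? position v)

  rank-mono : ∀ {u v} → U u ≡ true → position u < position v → rank u < rank v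
  rank-mono {u} {v} Uu u<v = sum-strict-≤ (λ w → *-monoʳ-≤ ⟦ U w ⟧ (weaken w)) u strict
    where
    weaken : ∀ w → 𝟙 (position w <? position u) ≤ 𝟙 (position w <? position v)
    weaken w with position w <? position u
    ... | no  _   = z≤n
    ... | yes w<u = ≤-reflexive (sym (𝟙-yes (position w <? position v) (<-trans w<u u<v)))
    strict : ⟦ U u ⟧ * 𝟙 (position u <? position u) < ⟦ U u ⟧ * 𝟙 (position u <? position v)
    strict rewrite Uu | 𝟙-no (position u <? position u) (<-irrefl refl)
                 | 𝟙-yes (position u <? position v) u<v = s≤s z≤n

  rank<card : ∀ {u} → U u ≡ true → rank u < card U
  rank<card {u} Uu = sum-strict-≤ (λ w → below w) u strict
    where
    below : ∀ w → ⟦ U w ⟧ * 𝟙 (position w <? position u) ≤ ⟦ U w ⟧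
    below w with position w <? position u
    ... | yes _ = ≤-reflexive (*-identityʳ _)
    ... | no  _ = ≤-trans (≤-reflexive (*-zeroʳ ⟦ U w ⟧)) z≤n
    strict : ⟦ U u ⟧ * 𝟙 (position u <? position u) < ⟦ U u ⟧
    strict rewrite Uu | 𝟙-no (position u <? position u) (<-irrefl refl) = s≤s z≤n

  rank-injective : ∀ {u v} → U u ≡ true → U v ≡ true → rank u ≡ rank v → u ≡ v
  rank-injective {u} {v} Uu Uv eq with <-cmp (position u) (position v)
  ... | tri< u<v _ _ = contradiction (rank-mono Uu u<v) (<-irrefl eq)
  ... | tri≈ _ u≡v _ = position-injective u≡v
  ... | tri> _ _ v<u = contradiction (rank-mono Uv v<u) (<-irrefl (sym eq))

  rank-reflects : ∀ {u v} → U u ≡ true → U v ≡ true → rank u < rank v → position u < position v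
  rank-reflects {u} {v} Uu Uv r with <-cmp (position u) (position v)
  ... | tri< u<v _ _ = u<v
  ... | tri≈ _ u≡v _ = contradiction r (<-irrefl (cong rank (position-injective u≡v)))
  ... | tri> _ _ v<u = contradiction (rank-mono Uv v<u) (<-asym r)

  record Edge (u v : Fin (n G)) : Set where
    field
      Uu  : U u ≡ true
      Uv  : U v ≡ true
      uv  : Adj G u v
      u<v : position u < position v

  edge : Fin (n G) → Fin (n G) → ℕ
  edge u v = (⟦ U u ⟧ * (⟦ U v ⟧ * ⟦ adj G u v ⟧)) * 𝟙 (position u <? position v)

  edge-sound : ∀ u v → 1 ≤ edge u v → Edge u v
  edge-sound u v pos with U u in Uu | U v in Uv | adj G u v in uv | position u <? position v
  ... | true | true | true | yes u<v = record { Uu = Uu ; Uv = Uv ; uv = uv ; u<v = u<v }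

  edge≤1 : ∀ u v → edge u v ≤ 1
  edge≤1 u v with U u | U v | adj G u v | position u <? position v
  ... | true  | true  | true  | yes _ = ≤-refl
  ... | true  | true  | true  | no _  = z≤n
  ... | true  | true  | false | _     = z≤n
  ... | true  | false | _     | _     = z≤n
  ... | false | _     | _     | _     = z≤n

  queue : Fin k → Fin (n G) → Fin (n G) → ℕ
  queue i u v = edge u v * 𝟙 (part u v F.≟ i)

  -- The edges of a queue are determined by the sum of the ranks of their endpoints:
  -- two distinct edges with the same rank sum are nested.
  queue-small : ∀ i → sum (λ u → sum (queue i u)) ≤ card U + card U ∸ 1
  queue-small i = sum-keys (queue i) (λ u v → rank u + rank v) _ queue≤1 bounded injective
    where
    queue≤1 : ∀ u v → queue i u v ≤ 1
    queue≤1 u v with part u v F.≟ i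
    ... | yes _ = ≤-trans (≤-reflexive (*-identityʳ _)) (edge≤1 u v)
    ... | no  _ = ≤-trans (≤-reflexive (*-zeroʳ (edge u v))) z≤n
    sound : ∀ u v → 1 ≤ queue i u v → Edge u v × part u v ≡ i
    sound u v p with weighted-indicator (part u v F.≟ i) p
    ... | p′ , eq = edge-sound u v p′ , eq
    bounded : ∀ u v → 1 ≤ queue i u v → rank u + rank v < card U + card U ∸ 1
    bounded u v p with sound u v p
    -- Each rank is at most `card U ∸ 1`, so the rank sums start at 0 and end at twice that value.
    ... | e , _ = ∸-monoˡ-≤ 1 (≤-trans (≤-reflexive (cong suc (sym (+-suc (rank u) (rank v)))))
                    (+-mono-≤ (rank<card (Edge.Uu e)) (rank<card (Edge.Uv e))))
    nested : ∀ {u v x y} → Edge u v → Edge x y → part u v ≡ part x y →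
      rank u + rank v ≡ rank x + rank y → ¬ position u < position x
    nested {u} {v} {x} {y} e e′ same eq u<x = no-nest u v x y uv (Edge.uv e′) same (u<x , Edge.u<v e′ , y<v)
      where
      open Edge e
      y<v : position y < position v
      y<v = rank-reflects (Edge.Uv e′) Uv (+-cancelˡ-< (rank u) _ _ (<-≤-trans
        (+-monoˡ-< (rank y) (rank-mono Uu u<x)) (≤-reflexive (sym eq))))
    injective : ∀ u v x y → 1 ≤ queue i u v → 1 ≤ queue i x y →
      rank u + rank v ≡ rank x + rank y → u ≡ x × v ≡ y
    injective u v x y p p′ eq with sound u v p | sound x y p′
    ... | e , i₁ | e′ , i₂ with <-cmp (position u) (position x)
    ...   | tri< u<x _ _ = contradiction u<x (nested e e′ (trans i₁ (sym i₂)) eq)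
    ...   | tri> _ _ x<u = contradiction x<u (nested e′ e (trans i₂ (sym i₁)) (sym eq))
    ...   | tri≈ _ u≡x _ with position-injective u≡x
    ...     | refl = refl , rank-injective (Edge.Uv e) (Edge.Uv e′) (+-cancelˡ-≡ (rank u) _ _ eq)

  edges-small : sum (λ u → sum (edge u)) ≤ k * (card U + card U ∸ 1)
  edges-small = begin
    sum (λ u → sum (λ v → edge u v))                  ≤⟨ sum-mono-≤ (λ u → sum-mono-≤ (λ v → in-queue u v)) ⟩
    sum (λ u → sum (λ v → sum (λ i → queue i u v)))   ≡⟨ sum-cong-≗ (λ u → ∑-comm (λ v i → queue i u v)) ⟩
    sum (λ u → sum (λ i → sum (λ v → queue i u v)))   ≡⟨ ∑-comm (λ u i → sum (λ v → queue i u v)) ⟩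
    sum (λ i → sum (λ u → sum (λ v → queue i u v)))   ≤⟨ sum-mono-≤ queue-small ⟩
    sum {k} (λ _ → card U + card U ∸ 1)               ≡⟨ sum-const k _ ⟩
    k * (card U + card U ∸ 1)                         ∎
    where
    open ≤-Reasoning
    in-queue : ∀ u v → edge u v ≤ sum (λ i → queue i u v)
    in-queue u v = ≤-trans (weighted-indicator⁻¹ (part u v F.≟ part u v) refl)
                           (term≤sum (λ i → queue i u v) (part u v))

  -- Each adjacent pair points to the right in exactly one of its two orders; the diagonal vanishes
  -- because there are no loops.
  pairs≡edges : pairs U U ≡ 2 * sum (λ u → sum (edge u))
  pairs≡edges = begin
    sum (λ u → ⟦ U u ⟧ * degree U u)
      ≡⟨ sum-cong-≗ (λ u → *-distribˡ-sum ⟦ U u ⟧ (λ v → ⟦ U v ⟧ * ⟦ adj G u v ⟧)) ⟩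
    sum (λ u → sum (λ v → ⟦ U u ⟧ * (⟦ U v ⟧ * ⟦ adj G u v ⟧)))
      ≡⟨ sum-cong-≗ (λ u → sum-cong-≗ (orient u)) ⟩
    sum (λ u → sum (λ v → edge u v + edge v u))
      ≡⟨ sum-cong-≗ (λ u → ∑-distrib-+ (edge u) (λ v → edge v u)) ⟩
    sum (λ u → sum (edge u) + sum (λ v → edge v u))
      ≡⟨ ∑-distrib-+ (λ u → sum (edge u)) (λ u → sum (λ v → edge v u)) ⟩
    sum (λ u → sum (edge u)) + sum (λ u → sum (λ v → edge v u))
      ≡⟨ cong (sum (λ u → sum (edge u)) +_) (trans (∑-comm (λ u v → edge v u)) (sym (+-identityʳ _))) ⟩
    2 * sum (λ u → sum (edge u)) ∎
    where
    open ≡-Reasoning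
    flip : ∀ u v → ⟦ U u ⟧ * (⟦ U v ⟧ * ⟦ adj G u v ⟧) ≡ ⟦ U v ⟧ * (⟦ U u ⟧ * ⟦ adj G v u ⟧)
    flip u v = trans (exchange ⟦ U u ⟧ ⟦ U v ⟧ _) (cong (λ b → ⟦ U v ⟧ * (⟦ U u ⟧ * ⟦ b ⟧)) (Graph.sym G u v))
      where
      exchange : ∀ x y z → x * (y * z) ≡ y * (x * z)
      exchange = solve-∀
    orient : ∀ u v → ⟦ U u ⟧ * (⟦ U v ⟧ * ⟦ adj G u v ⟧) ≡ edge u v + edge v u
    orient u v with <-cmp (position u) (position v)
    ... | tri< u<v _ v≮u rewrite 𝟙-yes (position u <? position v) u<v | 𝟙-no (position v <? position u) v≮u
      | *-zeroʳ (⟦ U v ⟧ * (⟦ U u ⟧ * ⟦ adj G v u ⟧)) = sym (trans (+-identityʳ _) (*-identityʳ _))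
    ... | tri> u≮v _ v<u rewrite 𝟙-no (position u <? position v) u≮v | 𝟙-yes (position v <? position u) v<u
      | *-zeroʳ (⟦ U u ⟧ * (⟦ U v ⟧ * ⟦ adj G u v ⟧)) = trans (flip u v) (sym (*-identityʳ _))
    ... | tri≈ u≮v u≡v v≮u rewrite 𝟙-no (position u <? position v) u≮v | 𝟙-no (position v <? position u) v≮u
      | position-injective u≡v | irrefl G v | *-zeroʳ ⟦ U v ⟧ | *-zeroʳ ⟦ U v ⟧ = refl

  sparse-pairs : 1 ≤ k → ∀ v → U v ≡ true → pairs U U < 4 * k * card U
  sparse-pairs 1≤k v Uv = begin-strict
    pairs U U                          ≡⟨ pairs≡edges ⟩
    2 * sum (λ u → sum (edge u))       ≤⟨ *-monoʳ-≤ 2 edges-small ⟩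
    -- Strictness comes from the `∸ 1`, as `k` and `card U` are positive.
    2 * (k * (card U + card U ∸ 1))    <⟨ *-monoʳ-< 2 (*-monoʳ-< k ⦃ >-nonZero 1≤k ⦄ (∸-monoʳ-< {card U + card U} (s≤s z≤n) (≤-trans (card-positive v Uv) (m≤m+n _ _)))) ⟩
    2 * (k * (card U + card U))        ≡⟨ collect k (card U) ⟩
    4 * k * card U                     ∎
    where
    open ≤-Reasoning
    collect : ∀ k c → 2 * (k * (c + c)) ≡ 4 * k * c
    collect = solve-∀

-- Exhaustive search through finitely many choices.

-- This turns existence up to double negation into existence. The candidates are rebuilt value by
-- value, so `P` must respect pointwise equality.
search : ∀ {n} {X : Set} (A : Fin n → List X) (P : (Fin n → X) → Set) →
  (∀ f → Dec (P f)) → (∀ {f f′} → (∀ v → f v ≡ f′ v) → P f → P f′) →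
  Dec (∃ λ f → (∀ v → f v ∈ A v) × P f)
search {zero} {X} A P P? resp = map′ (λ p → void , (λ ()) , p) (λ (f , _ , p) → resp (λ ()) p) (P? void)
  where
  void : Fin 0 → X
  void ()
search {suc n} {X} A P P? resp = map′ build split
  (any? (λ x → search (A ∘ suc) (λ f → P (x ▹ f)) (λ f → P? (x ▹ f)) (λ eq → resp (extend eq))) (A zero))
  where
  extend : ∀ {x} {f f′ : Fin n → X} → (∀ v → f v ≡ f′ v) → ∀ v → (x ▹ f) v ≡ (x ▹ f′) v
  extend eq zero    = refl
  extend eq (suc v) = eq v
  build : Any _ (A zero) → ∃ λ f → (∀ v → f v ∈ A v) × P f
  build some with find some
  ... | x , x∈A , f , f∈A , p = x ▹ f , (λ { zero → x∈A ; (suc v) → f∈A v }) , p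
  split : (∃ λ f → (∀ v → f v ∈ A v) × P f) → Any _ (A zero)
  split (f , f∈A , p) = lose (f∈A zero)
    (f ∘ suc , f∈A ∘ suc , resp (λ { zero → refl ; (suc v) → refl }) p)

-- Induction on the coloured vertex set.

module Induction {n : ℕ} (adj : Fin n → Fin n → Bool) (adj-sym : ∀ u v → adj u v ≡ adj v u)
  (adj-irrefl : ∀ v → adj v v ≡ false) (q : ℕ) (1≤q : 1 ≤ q)
  (L : Fin n → List ℕ) (L-unique : ∀ v → Unique (L v)) (L-large : ∀ v → q ≤ length (L v)) where

  open Pairs adj adj-sym

  first-colour : ∀ v → ∃ λ c → c ∈ L v
  first-colour v with L v | L-large v
  ... | c ∷ _ | _ = c , here refl
  ... | []    | q≤0 = contradiction (≤-trans 1≤q q≤0) λ ()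

  -- Strong induction on `card U`: the edge bound `few` yields a critical `S`, which is nonempty, so
  -- the rest of `U` is a smaller case.
  grow : (t : ℕ) → (∀ U v → U v ≡ true → (2 + t) * pairs U U < 2 * suc t * q * card U) →
    (Good : (Fin n → Bool) → Set) → (∀ U → (∀ v → U v ≡ false) → Good U) →
    (∀ U S → Selection.Critical adj adj-sym q t U S → Good (U ∖ S) → ¬ ¬ Good U) →
    ∀ U → ¬ ¬ Good U
  grow t few Good empty extend U = <-rec (λ m → ∀ U → card U ≡ m → ¬ ¬ Good U) step (card U) U refl
    where
    step : ∀ m → (∀ {k} → k < m → ∀ U → card U ≡ k → ¬ ¬ Good U) → ∀ U → card U ≡ m → ¬ ¬ Good U
    step _ rec U refl none with 1 ≤? card U
    ... | no  card≱1 = none (empty U outside)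
      where
      outside : ∀ v → U v ≡ false
      outside v with U v in Uv
      ... | false = refl
      ... | true  = contradiction (card-positive v Uv) card≱1
    ... | yes card≥1 with sum-positive (λ v → ⟦ U v ⟧) card≥1
    ...   | v , pos = ¬¬-critical (few U v Uv) λ (S , critical) →
              let (w , Sw) = critical-nonempty critical in
              rec (card-∖< (S⊆U critical) w Sw) (U ∖ S) refl λ good → extend U S critical good none
      where
      open Selection adj adj-sym q t U
      Uv : U v ≡ true
      Uv with true ← U v = refl

  module Step (t : ℕ) {U S : Fin n → Bool} (critical : Selection.Critical adj adj-sym q t U S)
    (g : Fin n → ℕ) (g∈L : ∀ v → g v ∈ L v) where

    open Selection adj adj-sym q t U using (S⊆U; degree<)
    open Weights t U S (S⊆U critical) public

    ω-diag : ∀ v → ω v v ≡ 0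
    ω-diag v rewrite adj-irrefl v = refl

    open Colourings ω ω-sym ω-diag L S g public
    -- The threshold is `suc t`: costs in `S` stay at most `t`, and one boundary edge already
    -- exceeds that.
    open Sparse q (suc t) L-unique L-large (degree< critical) boundary public

    adjacent : ∀ {u w} → U w ≡ true → S u ≡ true → adj u w ≡ true → 1 ≤ ω u w
    adjacent {u} {w} Uw Su uw = ≤-trans (≤-reflexive (sym (cong₂ (λ x y → ⟦ x ⟧ * ⟦ y ⟧) Uw uw))) (ω-positive u w Su)

    -- A crossing edge contradicts `mono-inside` at its end outside `S`. Hence the new colouring of
    -- `S` and the old one elsewhere do not interact.
    same-side : ∀ {f u w} → Optimal f → U u ≡ true → U w ≡ true → adj u w ≡ true → f w ≡ f u → S u ≡ S w
    same-side {f} {u} {w} opt Uu Uw uw eq with S u in Su | S w in Sw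
    ... | true  | true  = refl
    ... | false | false = refl
    ... | true  | false = trans (sym (mono-inside opt (neighbour-sym (adjacent Uw Su uw)) (sym eq))) Sw
    ... | false | true  = trans (sym Su)
      (mono-inside opt (neighbour-sym (adjacent Uu Sw (trans (adj-sym w u) uw))) eq)

  ∖-intro : ∀ (U S : Fin n → Bool) {v} → U v ≡ true → S v ≡ false → (U ∖ S) v ≡ true
  ∖-intro U S Uv Sv rewrite Uv | Sv = refl

  Matching : (Fin n → Bool) → (Fin n → ℕ) → Set
  Matching U f = ∀ v → U v ≡ true → sum (λ u → ⟦ U u ⟧ * (⟦ adj v u ⟧ * 𝟙 (f u ≟ f v))) ≤ 1

  -- On `S` the optimal cost is at most 1. Elsewhere the neighbours in the same colour also avoid
  -- `S`, and there `f` is `g`.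
  matching-step : ∀ U S → Selection.Critical adj adj-sym q 1 U S →
    (∃ λ f → (∀ v → f v ∈ L v) × Matching (U ∖ S) f) → ¬ ¬ ∃ λ f → (∀ v → f v ∈ L v) × Matching U f
  matching-step U S critical (g , g∈L , matching) none = ¬¬-optimal g∈L λ (f , opt) →
    none (f , proj₁ (proj₁ opt) , extended f opt)
    where
    open Step 1 critical g g∈L
    extended : ∀ f → Optimal f → Matching U f
    extended f opt v Uv with S v in Sv
    ... | true  = ≤-trans (sum-mono-≤ inside) (≤-pred (optimal-cost< opt Sv))
      where
      inside : ∀ u → ⟦ U u ⟧ * (⟦ adj v u ⟧ * 𝟙 (f u ≟ f v)) ≤ ω v u * 𝟙 (f u ≟ f v)
      inside u = ≤-trans (≤-reflexive (sym (*-assoc ⟦ U u ⟧ _ _))) (*-monoˡ-≤ (𝟙 (f u ≟ f v)) (ω-positive v u Sv))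
    ... | false = ≤-trans (sum-mono-≤ outside) (matching v (∖-intro U S Uv Sv))
      where
      outside : ∀ u → ⟦ U u ⟧ * (⟦ adj v u ⟧ * 𝟙 (f u ≟ f v)) ≤ ⟦ (U ∖ S) u ⟧ * (⟦ adj v u ⟧ * 𝟙 (g u ≟ g v))
      outside u with U u in Uu | adj v u in vu | f u ≟ f v
      ... | false | _     | _      = z≤n
      ... | true  | false | _      = z≤n
      ... | true  | true  | no _   = z≤n
      ... | true  | true  | yes eq = ≤-reflexive (sym (cong₂ (λ a b → ⟦ true ∧ not a ⟧ * (1 * b)) Su (𝟙-yes (g u ≟ g v) same)))
        where
        Su : S u ≡ false
        Su = trans (sym (same-side opt Uv Uu vu eq)) Sv
        same : g u ≡ g v
        same = trans (sym (proj₂ (proj₁ opt) u Su)) (trans eq (proj₂ (proj₁ opt) v Sv))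

  matching-colouring : (∀ U v → U v ≡ true → 3 * pairs U U < 4 * q * card U) →
    ∃ λ f → (∀ v → f v ∈ L v) × Matching (λ _ → true) f
  matching-colouring few = decidable-stable (search L (Matching _) matching? respects)
    (grow 1 few
      (λ U → ∃ λ f → (∀ v → f v ∈ L v) × Matching U f)
      (λ U none → proj₁ ∘ first-colour , proj₂ ∘ first-colour , λ v Uv → contradiction (trans (sym Uv) (none v)) λ ())
      matching-step (λ _ → true))
    where
    matching? : ∀ f → Dec (Matching (λ _ → true) f)
    matching? f = map′ (λ p v _ → p v) (λ p v → p v refl) (all? λ v → _ ≤? 1)
    respects : ∀ {f f′} → (∀ v → f v ≡ f′ v) → Matching (λ _ → true) f → Matching (λ _ → true) f′
    respects {f} {f′} eq matching v Uv = ≤-trans (≤-reflexive (sum-cong-≗ λ u →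
      cong₂ (λ x y → 1 * (⟦ adj v u ⟧ * 𝟙 (x ≟ y))) (sym (eq u)) (sym (eq v)))) (matching v Uv)

  -- `B` is constant on each monochromatic component inside `U`, which therefore fits into one
  -- block. This certificate can be found by search and glued along `S`.
  Blocks : (Fin n → Bool) → (Fin n → ℕ) → (Fin n → Block n) → Set
  Blocks U f B = (∀ u → u ∈ elements (B u)) ×
    (∀ u w → U u ≡ true → U w ≡ true → adj u w ≡ true → f w ≡ f u → B u ≡ B w)

  Blocked : (Fin n → Bool) → Set
  Blocked U = ∃ λ f → (∀ v → f v ∈ L v) × ∃ λ B → Blocks U f B

  blocks-step : ∀ U S → Selection.Critical adj adj-sym q 2 U S → Blocked (U ∖ S) → ¬ ¬ Blocked U
  blocks-step U S critical (g , g∈L , Bg , selfg , sameg) none =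
    ¬¬-small g∈L λ (f , opt , Bf , selff , samef) → none (f , proj₁ (proj₁ opt) , extended f opt Bf selff samef)
    where
    open Step 2 critical g g∈L
    -- For `t` equal to 2 both summands of `Selection.sparse` have the factor 2, which cancels.
    sparse : ∀ X → X ⊆ᵇ S → ∀ v → X v ≡ true →
      sum (λ v → ⟦ X v ⟧ * sum (λ u → ω v u + ⟦ X u ⟧ * ω v u)) < sum (λ v → ⟦ X v ⟧ * (q * 3))
    sparse X X⊆S v Xv = *-cancelˡ-< 2 _ _ (begin-strict
      2 * sum (λ v → ⟦ X v ⟧ * sum (λ u → ω v u + ⟦ X u ⟧ * ω v u))
        ≡⟨ cong (2 *_) (trans (sum-cong-≗ distribute) (∑-distrib-+ (λ v → ⟦ X v ⟧ * sum (ω v)) (λ v → ⟦ X v ⟧ * inner v))) ⟩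
      2 * (sum (λ v → ⟦ X v ⟧ * sum (ω v)) + sum (λ v → ⟦ X v ⟧ * inner v))
        ≡⟨ *-distribˡ-+ 2 (sum (λ v → ⟦ X v ⟧ * sum (ω v))) _ ⟩
      2 * sum (λ v → ⟦ X v ⟧ * sum (ω v)) + 2 * sum (λ v → ⟦ X v ⟧ * inner v)
        <⟨ Selection.sparse adj adj-sym q 2 U critical X X⊆S v Xv ⟩
      2 * sum (λ v → ⟦ X v ⟧ * (q * 3)) ∎)
      where
      open ≤-Reasoning
      inner : Fin n → ℕ
      inner v = sum (λ u → ⟦ X u ⟧ * ω v u)
      distribute : ∀ v → ⟦ X v ⟧ * sum (λ u → ω v u + ⟦ X u ⟧ * ω v u) ≡ ⟦ X v ⟧ * sum (ω v) + ⟦ X v ⟧ * inner v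
      distribute v = trans (cong (⟦ X v ⟧ *_) (∑-distrib-+ (ω v) (λ u → ⟦ X u ⟧ * ω v u))) (*-distribˡ-+ ⟦ X v ⟧ (sum (ω v)) (inner v))
    open Clusters ω ω-sym ω-diag L S g q L-unique L-large (Selection.degree< adj adj-sym q 2 U critical) boundary sparse using (¬¬-small)
    extended : ∀ f → Optimal f → (Bf : Fin n → Block n) → (∀ u → u ∈ elements (Bf u)) →
      (∀ u w → u ∉ [] → w ∉ [] → 1 ≤ ω u w → f w ≡ f u → Bf u ≡ Bf w) → ∃ λ B → Blocks U f B
    extended f opt Bf selff samef = B , self , same
      where
      B : Fin n → Block n
      B u = if S u then Bf u else Bg u
      self : ∀ u → u ∈ elements (B u)
      self u with S u
      ... | true  = selff u
      ... | false = selfg u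
      same : ∀ u w → U u ≡ true → U w ≡ true → adj u w ≡ true → f w ≡ f u → B u ≡ B w
      same u w Uu Uw uw eq with S u in Su | S w in Sw | same-side opt Uu Uw uw eq
      ... | true  | true  | _ = samef u w (λ ()) (λ ()) (adjacent Uw Su uw) eq
      ... | false | false | _ = sameg u w (∖-intro U S Uu Su) (∖-intro U S Uw Sw) uw
        (trans (sym (proj₂ (proj₁ opt) w Sw)) (trans eq (proj₂ (proj₁ opt) u Su)))

  blocked-colouring : (∀ U v → U v ≡ true → 4 * pairs U U < 6 * q * card U) → Blocked (λ _ → true)
  blocked-colouring few = let (f , f∈L , B , _ , blocks) = decidable-stable (search L Q Q? Q-respects) ¬¬-found
    in f , f∈L , B , blocks
    where
    all-blocks : List (Block n)
    all-blocks = cartesianProduct (allFin n) (cartesianProduct (allFin n) (allFin n))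
    ∈-all : ∀ b → b ∈ all-blocks
    ∈-all (x , y , z) = ∈-cartesianProduct⁺ (∈-allFin x) (∈-cartesianProduct⁺ (∈-allFin y) (∈-allFin z))
    open import Data.List.Membership.DecPropositional (F._≟_ {n}) using (_∈?_)
    Q : (Fin n → ℕ) → Set
    Q f = ∃ λ B → (∀ v → B v ∈ all-blocks) × Blocks (λ _ → true) f B
    Q? : ∀ f → Dec (Q f)
    Q? f = search (λ _ → all-blocks) (Blocks _ f) blocks? respects
      where
      blocks? : ∀ B → Dec (Blocks (λ _ → true) f B)
      blocks? B = (all? λ u → u ∈? elements (B u)) ×-dec
        map′ (λ p u w _ _ → p u w) (λ p u w → p u w refl refl)
          (all? λ u → all? λ w → (adj u w ≟ᵇ true) →-dec ((f w ≟ f u) →-dec ≡-dec F._≟_ (≡-dec F._≟_ F._≟_) (B u) (B w)))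
      respects : ∀ {B B′} → (∀ v → B v ≡ B′ v) → Blocks (λ _ → true) f B → Blocks (λ _ → true) f B′
      respects eq (self , same) = (λ u → subst (λ b → u ∈ elements b) (eq u) (self u)) ,
        λ u w Uu Uw uw fe → trans (sym (eq u)) (trans (same u w Uu Uw uw fe) (eq w))
    Q-respects : ∀ {f f′} → (∀ v → f v ≡ f′ v) → Q f → Q f′
    Q-respects eq (B , B∈ , self , same) = B , B∈ , self ,
      λ u w Uu Uw uw fe → same u w Uu Uw uw (trans (eq w) (trans fe (sym (eq u))))
    ¬¬-found : ¬ ¬ ∃ λ f → (∀ v → f v ∈ L v) × Q f
    ¬¬-found none = grow 2 few Blocked
      (λ U outside → proj₁ ∘ first-colour , proj₂ ∘ first-colour ,
        (λ v → v , v , v) , (λ _ → here refl) , λ u w Uu → contradiction (trans (sym Uu) (outside u)) λ ())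
      blocks-step (λ _ → true) λ (f , f∈L , B , blocks) → none (f , f∈L , B , (λ v → ∈-all (B v)) , blocks)

-- From sums and blocks to defect and clustering.

length-filter : ∀ {A : Set} {P : A → Set} (P? : ∀ x → Dec (P x)) {m} (h : Fin m → A) →
  length (filter P? (tabulate h)) ≡ sum (λ i → 𝟙 (P? (h i)))
length-filter P? {zero}  h = refl
length-filter P? {suc m} h with P? (h zero)
... | yes _ = cong suc (length-filter P? (h ∘ suc))
... | no  _ = length-filter P? (h ∘ suc)

-- The factor 1 is the indicator of the full vertex set, to match the sum in `Matching`.
monoDeg≡ : ∀ G c v → monoDeg G c v ≡ sum (λ u → 1 * (⟦ adj G v u ⟧ * 𝟙 (c u ≟ c v)))
monoDeg≡ G c v = trans (length-filter (λ w → (adj G v w ≟ᵇ true) ×-dec (c w ≟ c v)) (λ w → w)) (sum-cong-≗ term)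
  where
  term : ∀ u → 𝟙 ((adj G v u ≟ᵇ true) ×-dec (c u ≟ c v)) ≡ 1 * (⟦ adj G v u ⟧ * 𝟙 (c u ≟ c v))
  term u with adj G v u | c u ≟ c v
  ... | true  | yes _ = refl
  ... | true  | no  _ = refl
  ... | false | yes _ = refl
  ... | false | no  _ = refl

-- A monochromatic walk from `v` can only alternate between `v` and its unique neighbour in its
-- colour.
defect⇒clustering : ∀ G c → HasDefect G 1 c → HasClustering G 2 c
defect⇒clustering G c defect v ws uniq reach = clustered
  where
  mono : Fin (n G) → Fin (n G) → ℕ
  mono x u = 1 * (⟦ adj G x u ⟧ * 𝟙 (c u ≟ c x))
  mono≤1 : ∀ x → sum (mono x) ≤ 1
  mono≤1 x = ≤-trans (≤-reflexive (sym (monoDeg≡ G c x))) (defect x)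
  mono-positive : ∀ {x u} → Adj G x u → c x ≡ c u → 1 ≤ mono x u
  mono-positive {x} {u} xu eq rewrite xu | 𝟙-yes (c u ≟ c x) (sym eq) = ≤-refl
  mono-sound : ∀ {x u} → 1 ≤ mono x u → Adj G x u × c x ≡ c u
  mono-sound {x} {u} pos with adj G x u | c u ≟ c x
  ... | true | yes eq = refl , sym eq
  isolated : ¬ 1 ≤ sum (mono v) → ∀ {w} → MonoReach G c v w → w ∈ v ∷ []
  isolated none MonoReach.here = here refl
  isolated none {w} (MonoReach.step r xw eq) with isolated none r
  ... | here refl = contradiction (≤-trans (mono-positive xw eq) (term≤sum (mono v) w)) none
  paired : ∀ {z} → Adj G v z → c v ≡ c z → ∀ {w} → MonoReach G c v w → w ∈ v ∷ z ∷ []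
  paired vz eq MonoReach.here = here refl
  paired {z} vz eq (MonoReach.step r xw eq′) with paired vz eq r
  ... | here refl         = there (here (support-one (mono v) (mono≤1 v) (mono-positive vz eq) (mono-positive xw eq′)))
  ... | there (here refl) = here (support-one (mono z) (mono≤1 z)
                              (mono-positive (trans (Graph.sym G z v) vz) (sym eq)) (mono-positive xw eq′))
  clustered : length ws ≤ 2
  clustered with 1 ≤? sum (mono v)
  ... | no none = ≤-trans (unique-⊆⇒length≤ uniq (All.map (isolated none) reach)) (s≤s z≤n)
  ... | yes pos = let (z , p) = sum-positive (mono v) pos ; (vz , eq) = mono-sound p
                  in unique-⊆⇒length≤ uniq (All.map (paired vz eq) reach)

blocks⇒clustering : ∀ G c (B : Fin (n G) → Block (n G)) → (∀ u → u ∈ elements (B u)) →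
  (∀ u w → Adj G u w → c w ≡ c u → B u ≡ B w) → HasClustering G 3 c
blocks⇒clustering G c B self same v ws uniq reach = unique-⊆⇒length≤ uniq
  (All.map (λ {w} r → subst (λ b → w ∈ elements b) (sym (same-block r)) (self w)) reach)
  where
  same-block : ∀ {w} → MonoReach G c v w → B v ≡ B w
  same-block MonoReach.here = refl
  same-block (MonoReach.step r uw eq) = trans (same-block r) (same _ _ uw (sym eq))

theorem28 : ∀ (k : ℕ) → 1 ≤ k → ∀ (G : Graph) → IsQueueGraph k G →
    Choosable G (3 * k) (HasDefect G 1)
    × Choosable G (3 * k) (HasClustering G 2)
    × Choosable G ((14 * k + 4) / 5) (HasClustering G 9)
    × Choosable G ((8 * k + 2) / 3) (HasClustering G (152 * k ∸ 13))
theorem28 k 1≤k G layout =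
    defective
  , (λ L assignment → let (c , c∈L , defect) = defective L assignment in c , c∈L , defect⇒clustering G c defect)
  , clustered ((14 * k + 4) / 5) 9 q₂-large (m≤n+m 3 6)
  , clustered ((8 * k + 2) / 3) (152 * k ∸ 13) q₃-large
      -- Blocks give clustering 3, and 152 - 13 = 136 + 3 covers the smallest case `k` = 1.
      (≤-trans (m≤n+m 3 136) (∸-monoˡ-≤ 13 (*-monoʳ-≤ 152 1≤k)))
  where
  open Pairs (adj G) (Graph.sym G) using (pairs)

  -- Used with `a` = 2 + t and `b` = 2 (t + 1) q. For t = 1 and q = 3k the hypothesis is an
  -- equality; for t = 2 it says that q is at least 8k/3.
  few : ∀ a b .{{_ : NonZero a}} → a * (4 * k) ≤ b → ∀ U v → U v ≡ true → a * pairs U U < b * card U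
  few a b 4ak≤b U v Uv = begin-strict
    a * pairs U U            <⟨ *-monoʳ-< a (Density.sparse-pairs layout U 1≤k v Uv) ⟩
    a * (4 * k * card U)     ≡⟨ *-assoc a (4 * k) (card U) ⟨
    a * (4 * k) * card U     ≤⟨ *-monoˡ-≤ (card U) 4ak≤b ⟩
    b * card U               ∎
    where open ≤-Reasoning

  defective : Choosable G (3 * k) (HasDefect G 1)
  defective L assignment =
    let (c , c∈L , matching) = Induction.matching-colouring (adj G) (Graph.sym G) (irrefl G) (3 * k)
          (≤-trans 1≤k (m≤n*m k 3)) L (proj₁ ∘ assignment) (proj₂ ∘ assignment)
          (few 3 (4 * (3 * k)) (≤-reflexive (exchange k)))
    in c , c∈L , λ v → ≤-trans (≤-reflexive (monoDeg≡ G c v)) (matching v refl)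
    where
    exchange : ∀ k → 3 * (4 * k) ≡ 4 * (3 * k)
    exchange = solve-∀

  clustered : ∀ q m → 8 * k ≤ 3 * q → 3 ≤ m → Choosable G q (HasClustering G m)
  clustered q m 8k≤3q 3≤m L assignment =
    let (c , c∈L , B , self , same) = Induction.blocked-colouring (adj G) (Graph.sym G) (irrefl G) q
          1≤q L (proj₁ ∘ assignment) (proj₂ ∘ assignment) (few 4 (6 * q) 16k≤6q)
    in c , c∈L , λ v ws uniq reach →
      ≤-trans (blocks⇒clustering G c B self (λ u w → same u w refl refl) v ws uniq reach) 3≤m
    where
    1≤q : 1 ≤ q
    1≤q = n≢0⇒n>0 λ { refl → <⇒≱ (≤-trans 1≤k (m≤n*m k 8)) 8k≤3q }
    16k≤6q : 4 * (4 * k) ≤ 6 * q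
    16k≤6q = subst₂ _≤_ (left k) (right q) (*-monoʳ-≤ 2 8k≤3q)
      where
      left : ∀ k → 2 * (8 * k) ≡ 4 * (4 * k)
      left = solve-∀
      right : ∀ q → 2 * (3 * q) ≡ 6 * q
      right = solve-∀

  -- The quotient is `m / d` rounded up, since a remainder modulo `d` is at most `d ∸ 1`.
  ceiling : ∀ m d .{{_ : NonZero d}} → m ≤ ((m + (d ∸ 1)) / d) * d
  ceiling m d = +-cancelˡ-≤ (d ∸ 1) _ _ (begin
    d ∸ 1 + m                  ≡⟨ +-comm (d ∸ 1) m ⟩
    N                          ≡⟨ m≡m%n+[m/n]*n N d ⟩
    N % d + N / d * d          ≤⟨ +-monoˡ-≤ (N / d * d) (∸-monoˡ-≤ 1 (m%n<n N d)) ⟩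
    d ∸ 1 + N / d * d          ∎)
    where
    open ≤-Reasoning
    N = m + (d ∸ 1)

  q₂-large : 8 * k ≤ 3 * ((14 * k + 4) / 5)
  q₂-large = *-cancelˡ-≤ 5 (begin
    -- 14/5 exceeds 8/3, because 3 · 14 = 5 · 8 + 2.
    5 * (8 * k)                       ≤⟨ m≤m+n _ (2 * k) ⟩
    5 * (8 * k) + 2 * k               ≡⟨ left k ⟩
    3 * (14 * k)                      ≤⟨ *-monoʳ-≤ 3 (ceiling (14 * k) 5) ⟩
    3 * ((14 * k + 4) / 5 * 5)        ≡⟨ right ((14 * k + 4) / 5) ⟩
    5 * (3 * ((14 * k + 4) / 5))      ∎)
    where
    open ≤-Reasoning
    left : ∀ k → 5 * (8 * k) + 2 * k ≡ 3 * (14 * k)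
    left = solve-∀
    right : ∀ q → 3 * (q * 5) ≡ 5 * (3 * q)
    right = solve-∀

  q₃-large : 8 * k ≤ 3 * ((8 * k + 2) / 3)
  q₃-large = ≤-trans (ceiling (8 * k) 3) (≤-reflexive (*-comm ((8 * k + 2) / 3) 3))
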